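{- Let $\lambda$ be a nonzero real number and let $x,y\in\mathbb{R}$. For every integer $n\ge 0$, \begin{align*} C_{n,\lambda}(x,y)&=\sum_{m=0}^{n}\sum_{k=0}^{[\frac{m}{2}]}\binom{n}{m}\lambda^{m-2k}(-1)^{k}y^{2k}S^{(1)}(m,2k)(x)_{n-m,\lambda}\\ &=\sum_{k=0}^{[\frac{n}{2}]}\sum_{m=2k}^{n}\binom{n}{m}\lambda^{m-2k}(-1)^{k}y^{2k}S^{(1)}(m,2k)(x)_{n-m,\lambda}. \end{align*} Also, for every integer $n\ge 1$, \begin{align*} S_{n,\lambda}(x,y)&=\sum_{m=1}^{n}\sum_{k=0}^{[\frac{m-1}{2}]}\binom{n}{m}\lambda^{m-2k-1}(-1)^{k}y^{2k+1}S^{(1)}(m,2k+1)(x)_{n-m,\lambda}\\ &=\sum_{k=0}^{[\frac{n-1}{2}]}\sum_{m=2k+1}^{n}\binom{n}{m}\lambda^{m-2k-1}(-1)^{k}y^{2k+1}S^{(1)}(m,2k+1)(x)_{n-m,\lambda}, \end{align*} and $S_{0,\lambda}(x,y)=0$.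
   Context: All generating functions are power series in $t$ around $t=0$. For nonzero $\lambda\in\mathbb{R}$ and complex $z$, the degenerate exponential is $e_\lambda^{z}(t)=(1+\lambda t)^{z/\lambda}$. The degenerate cosine and sine functions are $\cos_\lambda^{(y)}(t)=\frac{e_\lambda^{iy}(t)+e_\lambda^{ -iy}(t)}{2}=\cos\left(\frac{y}{\lambda}\log(1+\lambda t)\right)$ and $\sin_\lambda^{(y)}(t)=\frac{e_\lambda^{iy}(t)-e_\lambda^{ -iy}(t)}{2i}=\sin\left(\frac{y}{\lambda}\log(1+\lambda t)\right)$, with $i=\sqrt{ -1}$. The degenerate cosine-polynomials $C_{n,\lambda}(x,y)$ and degenerate sine-polynomials $S_{n,\lambda}(x,y)$ are defined by $e_\lambda^{x}(t)\cos_\lambda^{(y)}(t)=\sum_{n=0}^{\infty}C_{n,\lambda}(x,y)\frac{t^n}{n!}$ and $e_\lambda^{x}(t)\sin_\lambda^{(y)}(t)=\sum_{n=0}^{\infty}S_{n,\lambda}(x,y)\frac{t^n}{n!}$. The generalized falling factorials are $(x)_{0,\lambda}=1$, $(x)_{n,\lambda}=x(x-\lambda)(x-2\lambda)\cdots(x-(n-1)\lambda)$ for $n\ge1$. The (signed) Stirling numbers of the first kind $S^{(1)}(n,l)$ are defined by $x(x-1)\cdots(x-n+1)=\sum_{l=0}^{n}S^{(1)}(n,l)x^l$ (the empty product being $1$ for $n=0$). $[a]$ denotes the greatest integer $\le a$. -}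

module Defs where

open import Level using (0ℓ)
open import Algebra.Bundles.Raw using (RawRing)
import Algebra.Definitions.RawSemiring as RawSemiringDefs
open import Data.Fin.Base using (toℕ)
open import Data.Integer.Base as ℤ using (ℤ; +_)
open import Data.Nat.Base as ℕ using (ℕ; zero; suc; _!; _⊔_)
import Data.Nat.Properties as ℕₚ
open import Data.Product.Base using (∃-syntax; _×_; _,_)
open import Data.Rational.Base as ℚ
  using (ℚ; 0ℚ; 1ℚ; ½; _/_; ∣_∣; 1/_; _≤_; _<_; positive; nonNegative; ≢-nonZero)
open import Data.Rational.Properties as ℚₚ using (_≟_)
open import Data.Rational.Solver using (module +-*-Solver)
open import Relation.Binary.PropositionalEquality
open import Relation.Nullary using (yes; no; contradiction)

-- Real numbers are Cauchy sequences of rationals, up to _≈ᴿ_.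

Cauchy : (ℕ → ℚ) → Set
Cauchy f = ∀ ε → 0ℚ < ε →
  ∃[ N ] (∀ m n → N ℕ.≤ m → N ℕ.≤ n → ∣ f m ℚ.- f n ∣ ≤ ε)

record ℝ : Set where
  constructor mkℝ
  field
    seq    : ℕ → ℚ
    cauchy : Cauchy seq

open ℝ public

infix 4 _≈ᴿ_

_≈ᴿ_ : ℝ → ℝ → Set
x ≈ᴿ y = ∀ ε → 0ℚ < ε →
  ∃[ N ] (∀ n → N ℕ.≤ n → ∣ seq x n ℚ.- seq y n ∣ ≤ ε)

-- "x is nonzero", in the usual constructive sense of being apart from 0
-- (classically equivalent to ¬ (x ≈ᴿ 0), and exactly what x⁻¹ needs).

infix 4 _#0

_#0 : ℝ → Set
x #0 = ∃[ ε ] (0ℚ < ε × ∃[ N ] (∀ n → N ℕ.≤ n → ε ≤ ∣ seq x n ∣))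

abstract

  half+half : ∀ ε → ½ ℚ.* ε ℚ.+ ½ ℚ.* ε ≡ ε
  half+half ε = trans (sym (ℚₚ.*-distribʳ-+ ε ½ ½)) (ℚₚ.*-identityˡ ε)

  *-pos : ∀ {p q} → 0ℚ < p → 0ℚ < q → 0ℚ < p ℚ.* q
  *-pos {p} {q} 0<p 0<q = ℚₚ.positive⁻¹ (p ℚ.* q)
    {{ℚₚ.pos*pos⇒pos p {{positive 0<p}} q {{positive 0<q}}}}

  half-pos : ∀ {ε} → 0ℚ < ε → 0ℚ < ½ ℚ.* ε
  half-pos = *-pos (ℚₚ.positive⁻¹ ½)

  *-mono-≤ : ∀ {a b c d} → 0ℚ ≤ b → 0ℚ ≤ c → a ≤ c → b ≤ d → a ℚ.* b ≤ c ℚ.* d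
  *-mono-≤ {b = b} {c} 0≤b 0≤c a≤c b≤d = ℚₚ.≤-trans
    (ℚₚ.*-monoʳ-≤-nonNeg b {{nonNegative 0≤b}} a≤c)
    (ℚₚ.*-monoˡ-≤-nonNeg c {{nonNegative 0≤c}} b≤d)

  const-cauchy : ∀ q → Cauchy (λ _ → q)
  const-cauchy q ε 0<ε = 0 , λ _ _ _ _ →
    subst (λ r → ∣ r ∣ ≤ ε) (sym (ℚₚ.+-inverseʳ q)) (ℚₚ.<⇒≤ 0<ε)

  +-cauchy : ∀ {f g} → Cauchy f → Cauchy g → Cauchy (λ n → f n ℚ.+ g n)
  +-cauchy {f} {g} cf cg ε 0<ε with cf (½ ℚ.* ε) (half-pos 0<ε)
                                  | cg (½ ℚ.* ε) (half-pos 0<ε)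
  ... | N , p | M , q = N ⊔ M , λ m n Nm Nn → begin
    ∣ (f m ℚ.+ g m) ℚ.- (f n ℚ.+ g n) ∣
      ≡⟨ cong ∣_∣ (regroup (f m) (g m) (f n) (g n)) ⟩
    ∣ (f m ℚ.- f n) ℚ.+ (g m ℚ.- g n) ∣
      ≤⟨ ℚₚ.∣p+q∣≤∣p∣+∣q∣ (f m ℚ.- f n) (g m ℚ.- g n) ⟩
    ∣ f m ℚ.- f n ∣ ℚ.+ ∣ g m ℚ.- g n ∣
      ≤⟨ ℚₚ.+-mono-≤ (p m n (ℕₚ.m⊔n≤o⇒m≤o N M Nm) (ℕₚ.m⊔n≤o⇒m≤o N M Nn))
                     (q m n (ℕₚ.m⊔n≤o⇒n≤o N M Nm) (ℕₚ.m⊔n≤o⇒n≤o N M Nn)) ⟩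
    ½ ℚ.* ε ℚ.+ ½ ℚ.* ε ≡⟨ half+half ε ⟩
    ε ∎
    where
    open ℚₚ.≤-Reasoning
    open +-*-Solver
    regroup : ∀ a b c d → (a ℚ.+ b) ℚ.- (c ℚ.+ d) ≡ (a ℚ.- c) ℚ.+ (b ℚ.- d)
    regroup = solve 4 (λ a b c d → (a :+ b) :- (c :+ d) := (a :- c) :+ (b :- d)) refl

  -‿cauchy : ∀ {f} → Cauchy f → Cauchy (λ n → ℚ.- f n)
  -‿cauchy {f} cf ε 0<ε with cf ε 0<ε
  ... | N , p = N , λ m n Nm Nn → subst (_≤ ε)
    (trans (sym (ℚₚ.∣-p∣≡∣p∣ (f m ℚ.- f n))) (cong ∣_∣ (ℚₚ.neg-distrib-+ (f m) (ℚ.- f n))))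
    (p m n Nm Nn)

  bounded : ∀ {f} → Cauchy f → ∃[ B ] (0ℚ < B × ∃[ N ] (∀ n → N ℕ.≤ n → ∣ f n ∣ ≤ B))
  bounded {f} cf with cf 1ℚ (ℚₚ.positive⁻¹ 1ℚ)
  ... | N , p = 1ℚ ℚ.+ ∣ f N ∣
              , ℚₚ.+-mono-<-≤ (ℚₚ.positive⁻¹ 1ℚ) (ℚₚ.0≤∣p∣ (f N))
              , N , λ n Nn → begin
    ∣ f n ∣                         ≡⟨ cong ∣_∣ (split (f n) (f N)) ⟩
    ∣ (f n ℚ.- f N) ℚ.+ f N ∣       ≤⟨ ℚₚ.∣p+q∣≤∣p∣+∣q∣ (f n ℚ.- f N) (f N) ⟩
    ∣ f n ℚ.- f N ∣ ℚ.+ ∣ f N ∣     ≤⟨ ℚₚ.+-monoˡ-≤ ∣ f N ∣ (p n N Nn ℕₚ.≤-refl) ⟩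
    1ℚ ℚ.+ ∣ f N ∣                  ∎
    where
    open ℚₚ.≤-Reasoning
    open +-*-Solver
    split : ∀ a b → a ≡ (a ℚ.- b) ℚ.+ b
    split = solve 2 (λ a b → a := (a :- b) :+ b) refl

  shrink : ∀ {ε B} → 0ℚ < ε → 0ℚ < B → ∃[ δ ] (0ℚ < δ × B ℚ.* δ ≡ ε)
  shrink {ε} {B} 0<ε 0<B = B⁻¹ ℚ.* ε , *-pos 0<B⁻¹ 0<ε , B*δ≡ε
    where
    instance
      B-pos : ℚ.Positive B
      B-pos = positive 0<B
      B≢0 : ℚ.NonZero B
      B≢0 = ℚₚ.pos⇒nonZero B
    B⁻¹ : ℚ
    B⁻¹ = 1/ B
    0<B⁻¹ : 0ℚ < B⁻¹
    0<B⁻¹ = ℚₚ.positive⁻¹ B⁻¹ {{ℚₚ.1/pos⇒pos B}}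
    B*δ≡ε : B ℚ.* (B⁻¹ ℚ.* ε) ≡ ε
    B*δ≡ε = trans (sym (ℚₚ.*-assoc B B⁻¹ ε))
                  (trans (cong (ℚ._* ε) (ℚₚ.*-inverseʳ B)) (ℚₚ.*-identityˡ ε))

  product-close : ∀ {a b c d B D δ η ε} → 0ℚ < B → 0ℚ < D →
    ∣ a ∣ ≤ B → ∣ d ∣ ≤ D → ∣ b ℚ.- d ∣ ≤ δ → ∣ a ℚ.- c ∣ ≤ η →
    B ℚ.* δ ≡ ½ ℚ.* ε → D ℚ.* η ≡ ½ ℚ.* ε → ∣ a ℚ.* b ℚ.- c ℚ.* d ∣ ≤ ε
  product-close {a} {b} {c} {d} {B} {D} {δ} {η} {ε} 0<B 0<D a≤B d≤D bd ac Bδ Dη = begin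
    ∣ a ℚ.* b ℚ.- c ℚ.* d ∣
      ≡⟨ cong ∣_∣ (regroup a b c d) ⟩
    ∣ a ℚ.* (b ℚ.- d) ℚ.+ d ℚ.* (a ℚ.- c) ∣
      ≤⟨ ℚₚ.∣p+q∣≤∣p∣+∣q∣ (a ℚ.* (b ℚ.- d)) (d ℚ.* (a ℚ.- c)) ⟩
    ∣ a ℚ.* (b ℚ.- d) ∣ ℚ.+ ∣ d ℚ.* (a ℚ.- c) ∣
      ≡⟨ cong₂ ℚ._+_ (ℚₚ.∣p*q∣≡∣p∣*∣q∣ a (b ℚ.- d)) (ℚₚ.∣p*q∣≡∣p∣*∣q∣ d (a ℚ.- c)) ⟩
    ∣ a ∣ ℚ.* ∣ b ℚ.- d ∣ ℚ.+ ∣ d ∣ ℚ.* ∣ a ℚ.- c ∣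
      ≤⟨ ℚₚ.+-mono-≤ (*-mono-≤ (ℚₚ.0≤∣p∣ (b ℚ.- d)) (ℚₚ.<⇒≤ 0<B) a≤B bd)
                     (*-mono-≤ (ℚₚ.0≤∣p∣ (a ℚ.- c)) (ℚₚ.<⇒≤ 0<D) d≤D ac) ⟩
    B ℚ.* δ ℚ.+ D ℚ.* η         ≡⟨ cong₂ ℚ._+_ Bδ Dη ⟩
    ½ ℚ.* ε ℚ.+ ½ ℚ.* ε         ≡⟨ half+half ε ⟩
    ε ∎
    where
    open ℚₚ.≤-Reasoning
    open +-*-Solver
    regroup : ∀ a b c d → a ℚ.* b ℚ.- c ℚ.* d ≡ a ℚ.* (b ℚ.- d) ℚ.+ d ℚ.* (a ℚ.- c)
    regroup = solve 4 (λ a b c d →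
      a :* b :- c :* d := a :* (b :- d) :+ d :* (a :- c)) refl

  *-cauchy : ∀ {f g} → Cauchy f → Cauchy g → Cauchy (λ n → f n ℚ.* g n)
  *-cauchy {f} {g} cf cg ε 0<ε =
    let B , 0<B , N₁ , f≤B = bounded cf
        D , 0<D , N₂ , g≤D = bounded cg
        δ , 0<δ , Bδ = shrink (half-pos 0<ε) 0<B
        η , 0<η , Dη = shrink (half-pos 0<ε) 0<D
        N₃ , p = cf η 0<η
        N₄ , q = cg δ 0<δ
        left : ∀ {k} → (N₁ ⊔ N₂) ⊔ (N₃ ⊔ N₄) ℕ.≤ k → N₁ ⊔ N₂ ℕ.≤ k
        left = ℕₚ.m⊔n≤o⇒m≤o (N₁ ⊔ N₂) (N₃ ⊔ N₄)
        right : ∀ {k} → (N₁ ⊔ N₂) ⊔ (N₃ ⊔ N₄) ℕ.≤ k → N₃ ⊔ N₄ ℕ.≤ k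
        right = ℕₚ.m⊔n≤o⇒n≤o (N₁ ⊔ N₂) (N₃ ⊔ N₄)
    in (N₁ ⊔ N₂) ⊔ (N₃ ⊔ N₄) , λ m n Nm Nn →
      product-close {f m} {g m} {f n} {g n} {ε = ε} 0<B 0<D
        (f≤B m (ℕₚ.m⊔n≤o⇒m≤o N₁ N₂ (left Nm)))
        (g≤D n (ℕₚ.m⊔n≤o⇒n≤o N₁ N₂ (left Nn)))
        (q m n (ℕₚ.m⊔n≤o⇒n≤o N₃ N₄ (right Nm)) (ℕₚ.m⊔n≤o⇒n≤o N₃ N₄ (right Nn)))
        (p m n (ℕₚ.m⊔n≤o⇒m≤o N₃ N₄ (right Nm)) (ℕₚ.m⊔n≤o⇒m≤o N₃ N₄ (right Nn)))
        Bδ Dη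

recip : ℚ → ℚ
recip q with q ≟ 0ℚ
... | yes _  = 0ℚ
... | no q≢0 = (1/ q) {{≢-nonZero q≢0}}

abstract

  recip-inverse : ∀ {ε} q → 0ℚ < ε → ε ≤ ∣ q ∣ → recip q ℚ.* q ≡ 1ℚ
  recip-inverse q 0<ε ε≤∣q∣ with q ≟ 0ℚ
  ... | yes refl = contradiction (ℚₚ.<-≤-trans 0<ε ε≤∣q∣) (ℚₚ.<-irrefl refl)
  ... | no q≢0   = ℚₚ.*-inverseˡ q {{≢-nonZero q≢0}}

  recip-cauchy : (x : ℝ) → x #0 → Cauchy (λ n → recip (seq x n))
  recip-cauchy x (δ , 0<δ , N , p) ε 0<ε
    with M , q ← cauchy x (ε ℚ.* (δ ℚ.* δ)) (*-pos 0<ε (*-pos 0<δ 0<δ))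
    = N ⊔ M , λ m n Nm Nn →
      let a   = seq x m ; c  = seq x n
          a⁻¹ = recip a ; c⁻¹ = recip c
          δ≤a = p m (ℕₚ.m⊔n≤o⇒m≤o N M Nm)
          δ≤c = p n (ℕₚ.m⊔n≤o⇒m≤o N M Nn)
      in ℚₚ.*-cancelʳ-≤-pos (δ ℚ.* δ) {{positive (*-pos 0<δ 0<δ)}} (begin
      ∣ a⁻¹ ℚ.- c⁻¹ ∣ ℚ.* (δ ℚ.* δ)
        ≤⟨ ℚₚ.*-monoˡ-≤-nonNeg ∣ a⁻¹ ℚ.- c⁻¹ ∣ {{nonNegative (ℚₚ.0≤∣p∣ (a⁻¹ ℚ.- c⁻¹))}}
             (*-mono-≤ (ℚₚ.<⇒≤ 0<δ) (ℚₚ.0≤∣p∣ c) δ≤c δ≤a) ⟩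
      ∣ a⁻¹ ℚ.- c⁻¹ ∣ ℚ.* (∣ c ∣ ℚ.* ∣ a ∣)
        ≡⟨ cong (∣ a⁻¹ ℚ.- c⁻¹ ∣ ℚ.*_) (sym (ℚₚ.∣p*q∣≡∣p∣*∣q∣ c a)) ⟩
      ∣ a⁻¹ ℚ.- c⁻¹ ∣ ℚ.* ∣ c ℚ.* a ∣
        ≡⟨ sym (ℚₚ.∣p*q∣≡∣p∣*∣q∣ (a⁻¹ ℚ.- c⁻¹) (c ℚ.* a)) ⟩
      ∣ (a⁻¹ ℚ.- c⁻¹) ℚ.* (c ℚ.* a) ∣
        ≡⟨ cong ∣_∣ (regroup a c a⁻¹ c⁻¹) ⟩
      ∣ (c⁻¹ ℚ.* c) ℚ.* (ℚ.- a) ℚ.+ (a⁻¹ ℚ.* a) ℚ.* c ∣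
        ≡⟨ cong₂ (λ u v → ∣ u ℚ.* (ℚ.- a) ℚ.+ v ℚ.* c ∣)
                 (recip-inverse c 0<δ δ≤c) (recip-inverse a 0<δ δ≤a) ⟩
      ∣ 1ℚ ℚ.* (ℚ.- a) ℚ.+ 1ℚ ℚ.* c ∣
        ≡⟨ cong ∣_∣ (swap a c) ⟩
      ∣ c ℚ.- a ∣
        ≤⟨ q n m (ℕₚ.m⊔n≤o⇒n≤o N M Nn) (ℕₚ.m⊔n≤o⇒n≤o N M Nm) ⟩
      ε ℚ.* (δ ℚ.* δ) ∎)
    where
    open ℚₚ.≤-Reasoning
    open +-*-Solver
    regroup : ∀ a c a′ c′ →
      (a′ ℚ.- c′) ℚ.* (c ℚ.* a) ≡ (c′ ℚ.* c) ℚ.* (ℚ.- a) ℚ.+ (a′ ℚ.* a) ℚ.* c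
    regroup = solve 4 (λ a c a′ c′ →
      (a′ :- c′) :* (c :* a) := (c′ :* c) :* (:- a) :+ (a′ :* a) :* c) refl
    swap : ∀ a c → 1ℚ ℚ.* (ℚ.- a) ℚ.+ 1ℚ ℚ.* c ≡ c ℚ.- a
    swap = solve 2 (λ a c → con 1ℚ :* (:- a) :+ con 1ℚ :* c := c :- a) refl

fromℚ : ℚ → ℝ
fromℚ q = mkℝ (λ _ → q) (const-cauchy q)

fromℤ : ℤ → ℝ
fromℤ z = fromℚ (z / 1)

fromℕ : ℕ → ℝ
fromℕ n = fromℤ (+ n)

-- Only the tail of a Cauchy sequence matters, so the junk value of recip at 0
-- is never seen when x #0.
inv : (x : ℝ) → x #0 → ℝ
inv x x#0 = mkℝ (λ n → recip (seq x n)) (recip-cauchy x x#0)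

ℝ-rawRing : RawRing 0ℓ 0ℓ
ℝ-rawRing = record
  { Carrier = ℝ
  ; _≈_     = _≈ᴿ_
  ; _+_     = λ x y → mkℝ (λ n → seq x n ℚ.+ seq y n) (+-cauchy {seq x} {seq y} (cauchy x) (cauchy y))
  ; _*_     = λ x y → mkℝ (λ n → seq x n ℚ.* seq y n) (*-cauchy {seq x} {seq y} (cauchy x) (cauchy y))
  ; -_      = λ x → mkℝ (λ n → ℚ.- seq x n) (-‿cauchy {seq x} (cauchy x))
  ; 0#      = fromℚ 0ℚ
  ; 1#      = fromℚ 1ℚ
  }

inv-inverse : ∀ x (x#0 : x #0) → RawRing._*_ ℝ-rawRing (inv x x#0) x ≈ᴿ fromℚ 1ℚ
inv-inverse x (δ , 0<δ , N , p) ε 0<ε = N , λ n Nn →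
  subst (λ q → ∣ q ℚ.- 1ℚ ∣ ≤ ε) (sym (recip-inverse (seq x n) 0<δ (p n Nn)))
        (ℚₚ.<⇒≤ 0<ε)

-- (a , b) stands for a + b i.
complexify : ∀ {c ℓ} → RawRing c ℓ → RawRing c ℓ
complexify R = record
  { Carrier = Carrier × Carrier
  ; _≈_     = λ { (a , b) (c , d) → a ≈ c × b ≈ d }
  ; _+_     = λ { (a , b) (c , d) → a + c , b + d }
  ; _*_     = λ { (a , b) (c , d) → a * c + - (b * d) , a * d + b * c }
  ; -_      = λ { (a , b) → - a , - b }
  ; 0#      = 0# , 0#
  ; 1#      = 1# , 0#
  }
  where open RawRing R

module RingOps {c ℓ} (R : RawRing c ℓ) where

  open RawRing R public
  open RawSemiringDefs rawSemiring public using (_^_; sum) renaming (_×_ to _·_)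

  infixl 6 _-_

  _-_ : Carrier → Carrier → Carrier
  x - y = x + - y

  -- Both bounds are inclusive; the sum is empty if b < a.
  ∑[_to_] : ℕ → ℕ → (ℕ → Carrier) → Carrier
  ∑[ a to b ] f = sum {suc b ℕ.∸ a} (λ i → f (a ℕ.+ toℕ i))

  fallingFactorial : Carrier → Carrier → ℕ → Carrier
  fallingFactorial lam x zero    = 1#
  fallingFactorial lam x (suc n) = fallingFactorial lam x n * (x - n · lam)

-- Formal power series, as coefficient sequences.
powerSeries : ∀ {c ℓ} → RawRing c ℓ → RawRing c ℓ
powerSeries R = record
  { Carrier = ℕ → Carrier
  ; _≈_     = λ f g → ∀ n → f n ≈ g n
  ; _+_     = λ f g n → f n + g n
  ; _*_     = λ f g n → ∑[ 0 to n ] (λ k → f k * g (n ℕ.∸ k))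
  ; -_      = λ f n → - f n
  ; 0#      = λ _ → 0#
  ; 1#      = λ { zero → 1# ; (suc _) → 0# }
  }
  where open RingOps R

module Series {c ℓ} (R : RawRing c ℓ) where

  open RingOps R
  private module S = RingOps (powerSeries R)

  infixr 8 _∙_
  infixr 9 _∘_

  X : S.Carrier
  X 1 = 1#
  X _ = 0#

  _∙_ : Carrier → S.Carrier → S.Carrier
  (a ∙ f) n = a * f n

  -- Substitution f(g(t)), meaningful when g has zero constant term: then gᵏ
  -- has no term of degree below k, so the sum may be cut off at k = n.
  _∘_ : S.Carrier → S.Carrier → S.Carrier
  (f ∘ g) n = ∑[ 0 to n ] (λ k → f k * (g S.^ k) n)

  module Exp (ι : ℚ → Carrier) where

    exp : S.Carrier
    exp n = ι ((+ 1 / (n !)) {{n ℕₚ.!≢0}})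

    -- log(1 + t) = t - t²/2 + t³/3 - ⋯
    log1+ : S.Carrier
    log1+ zero    = 0#
    log1+ (suc k) = (- 1#) ^ k * ι (+ 1 / suc k)

    -- (1 + lam t)ᵃ, i.e. exp (a log (1 + lam t)).
    power1+ : (lam a : Carrier) → S.Carrier
    power1+ lam a = exp ∘ (a ∙ (log1+ ∘ (lam ∙ X)))

-- Signed Stirling numbers of the first kind: S¹ n l is the coefficient of xˡ
-- in x (x - 1) ⋯ (x - n + 1), computed in ℤ[x] ⊆ ℤ⟦x⟧.

private
  module ℤ⟦x⟧ = RingOps (powerSeries ℤ.+-*-rawRing)

S¹ : ℕ → ℕ → ℤ
S¹ n = ℤ⟦x⟧.fallingFactorial ℤ⟦x⟧.1# (Series.X ℤ.+-*-rawRing) n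

ℂ-rawRing : RawRing 0ℓ 0ℓ
ℂ-rawRing = complexify ℝ-rawRing

module R = RingOps ℝ-rawRing
module C = RingOps ℂ-rawRing
module C⟦t⟧ = RingOps (powerSeries ℂ-rawRing)

ℂ : Set
ℂ = C.Carrier

fromℝ : ℝ → ℂ
fromℝ x = x , R.0#

𝕚 : ℂ
𝕚 = R.0# , R.1#

½ᶜ : ℂ
½ᶜ = fromℝ (fromℚ ½)

-- 1/(2i) = -i/2
1/2𝕚 : ℂ
1/2𝕚 = ½ᶜ C.* (C.- 𝕚)

open Series ℂ-rawRing using (_∙_; module Exp)
open Exp (λ q → fromℝ (fromℚ q)) using (power1+)

-- The aₙ in f = ∑ aₙ tⁿ/n!, that is, n! times the coefficient of tⁿ. The
-- polynomials below are therefore complex a priori.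
egfCoeff : C⟦t⟧.Carrier → ℕ → ℂ
egfCoeff f n = fromℝ (fromℕ (n !)) C.* f n

module _ (lam : ℝ) (lam#0 : lam #0) where

  degExp : ℂ → C⟦t⟧.Carrier
  degExp z = power1+ (fromℝ lam) (z C.* fromℝ (inv lam lam#0))

  degCos : ℝ → C⟦t⟧.Carrier
  degCos y = ½ᶜ ∙ (degExp (𝕚 C.* fromℝ y) C⟦t⟧.+ degExp (C.- (𝕚 C.* fromℝ y)))

  degSin : ℝ → C⟦t⟧.Carrier
  degSin y = 1/2𝕚 ∙ (degExp (𝕚 C.* fromℝ y) C⟦t⟧.- degExp (C.- (𝕚 C.* fromℝ y)))

  cosPoly : ℕ → ℝ → ℝ → ℂ
  cosPoly n x y = egfCoeff (degExp (fromℝ x) C⟦t⟧.* degCos y) n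

  sinPoly : ℕ → ℝ → ℝ → ℂ
  sinPoly n x y = egfCoeff (degExp (fromℝ x) C⟦t⟧.* degSin y) n

{-# OPTIONS --safe #-}
module Submission where

-- Put Δ = (1 + lam t) d/dt, a derivation of R⟦t⟧. If g has zero constant term and
-- Δ g = c is constant, Leibniz' rule gives Δ gᵏ = k c gᵏ⁻¹, hence Δ (exp ∘ g) =
-- c (exp ∘ g). For g = a log (1 + lam t) one has c = a lam, and comparing
-- coefficients gives n! [tⁿ] (1 + lam t)ᵃ = (a lam)_{n,lam}. At a lam = iy this is
-- expanded in Stirling numbers and split by the parity of the power of iy; complex
-- conjugation gives the value at -iy. The binomial convolution with (x)_{n,lam}
-- yields the first formulas. The second ones are an exchange of summation, where
-- the vanishing of S¹ m l for l > m takes care of the bounds.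

open import Defs
open import Algebra.Bundles using (CommutativeRing)
open import Algebra.Bundles.Raw using (RawRing)
import Algebra.Morphism.Construct.Composition as Composition
open import Algebra.Morphism.Structures using (IsRingHomomorphism)
import Algebra.Properties.Ring as RingProperties
import Algebra.Properties.Semiring.Mult as Multiples
import Algebra.Properties.Semiring.Sum as Sums
import Algebra.Solver.Ring.NaturalCoefficients.Default as SemiringSolver
open import Data.Fin.Base using (toℕ)
open import Data.Fin.Permutation using (reverse)
import Data.Fin.Properties as Finₚ
open import Data.Integer.Base as ℤ using (ℤ; +_)
import Data.Integer.Properties as ℤₚ
open import Data.Nat.Base as ℕ using (ℕ; zero; suc; _∸_; ⌊_/2⌋; _!; s≤s; z≤n; s<s; z<s)
open import Data.Nat.Combinatorics using (_C_; nCk≡n!/k![n-k]!; k![n∸k]!∣n!)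
open import Data.Nat.DivMod using (m/n*n≡m)
import Data.Nat.Properties as ℕₚ
open import Data.Product.Base using (_×_; _,_)
open import Data.Rational.Base as ℚ using (ℚ; 0ℚ; 1ℚ; ½; _/_)
import Data.Rational.Properties as ℚₚ
open import Data.Rational.Solver using (module +-*-Solver)
open import Data.Rational.Unnormalised.Base as ℚᵘ using (mkℚᵘ; *≡*)
import Data.Rational.Unnormalised.Properties as ℚᵘₚ
open import Data.Sum.Base using (inj₁; inj₂)
open import Function.Base using (_∘_)
open import Level using (0ℓ)
open import Relation.Binary.PropositionalEquality as ≡ using (_≡_)
import Relation.Binary.Reasoning.Setoid as SetoidReasoning

-- The choice of Δ over d/dt is forced by the logarithm: d/dt log (1 + lam t) = lam / (1 + lam t) is
-- not constant, and the factor 1 + lam t clears this denominator without inverting a series.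
-- Composition is defined coefficientwise by a sum cut off at the degree, so the chain rule has to
-- be proved on coefficients; only the case of constant Δ g is established. With P = (1 + lam t)ᵃ
-- and c = a lam, the equation Δ P = c P says (n + 1) Pₙ₊₁ = (c - n lam) Pₙ, which is the recursion
-- of the falling factorial once n! is multiplied in. Division by lam is confined to the exponent a
-- = z / lam and disappears in c = z.
--
-- The polynomials are complex by definition, so part of the claim is that they are real. This comes
-- from writing (iy)_{m,lam} = P + iQ and (-iy)_{m,lam} = P - iQ with P and Q in the image of the
-- reals: half the sum is P, and the difference divided by 2i is Q.

-- Finite sums over initial segments of the natural numbers

module FiniteSums {c ℓ} (R : CommutativeRing c ℓ) where

  open CommutativeRing R hiding (zero; _-_)
  open RingOps rawRing using (sum; ∑[_to_])
  open SetoidReasoning setoid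
  private module S = Sums semiring

  ∑< : ℕ → (ℕ → Carrier) → Carrier
  ∑< n f = sum {n} (λ i → f (toℕ i))

  ∑-cong : ∀ n {f g : ℕ → Carrier} → (∀ k → k ℕ.< n → f k ≈ g k) → ∑< n f ≈ ∑< n g
  ∑-cong n f≈g = S.sum-cong-≋ {n} (λ i → f≈g (toℕ i) (Finₚ.toℕ<n i))

  ∑-zero : ∀ n {f : ℕ → Carrier} → (∀ k → k ℕ.< n → f k ≈ 0#) → ∑< n f ≈ 0#
  ∑-zero n f≈0 = trans (∑-cong n f≈0) (S.sum-replicate-zero n)

  ∑-last : ∀ n (f : ℕ → Carrier) → ∑< (suc n) f ≈ ∑< n f + f n
  ∑-last zero    f = +-comm _ _
  ∑-last (suc n) f = begin
    f 0 + ∑< (suc n) (f ∘ suc)           ≈⟨ +-congˡ (∑-last n (f ∘ suc)) ⟩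
    f 0 + (∑< n (f ∘ suc) + f (suc n))   ≈⟨ sym (+-assoc _ _ _) ⟩
    ∑< (suc n) f + f (suc n)             ∎

  ∑-+ : ∀ n (f g : ℕ → Carrier) → ∑< n (λ k → f k + g k) ≈ ∑< n f + ∑< n g
  ∑-+ n f g = S.∑-distrib-+ {n} (λ i → f (toℕ i)) (λ i → g (toℕ i))

  ∑-*ˡ : ∀ n x (f : ℕ → Carrier) → x * ∑< n f ≈ ∑< n (λ k → x * f k)
  ∑-*ˡ n x f = S.*-distribˡ-sum {n} x (λ i → f (toℕ i))

  ∑-*ʳ : ∀ n x (f : ℕ → Carrier) → ∑< n f * x ≈ ∑< n (λ k → f k * x)
  ∑-*ʳ n x f = S.*-distribʳ-sum {n} x (λ i → f (toℕ i))

  ∑-swap : ∀ m n (f : ℕ → ℕ → Carrier) →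
    ∑< m (λ i → ∑< n (f i)) ≈ ∑< n (λ j → ∑< m (λ i → f i j))
  ∑-swap m n f = S.∑-comm {m} {n} (λ i j → f (toℕ i) (toℕ j))

  -- Serves to move the running index of a convolution from its first factor to its second.
  ∑-reverse : ∀ n (f : ℕ → Carrier) → ∑[ 0 to n ] f ≈ ∑[ 0 to n ] (λ k → f (n ∸ k))
  ∑-reverse n f = trans (S.∑-permute {suc n} {suc n} (λ i → f (toℕ i)) reverse)
    (S.sum-cong-≋ {suc n} λ i → reflexive (≡.cong f (Finₚ.opposite-prop i)))

  ∑-truncate : ∀ {m n} {f : ℕ → Carrier} → m ℕ.≤ n → (∀ k → m ℕ.≤ k → f k ≈ 0#) →
    ∑< n f ≈ ∑< m f
  ∑-truncate {n = n} z≤n f≈0 = ∑-zero n (λ k _ → f≈0 k z≤n)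
  ∑-truncate (s≤s m≤n)   f≈0 = +-congˡ (∑-truncate m≤n (λ k m≤k → f≈0 (suc k) (s≤s m≤k)))

  -- For `n = suc b` the right side is `∑[ m to b ] f` by definition. Truncated subtraction makes it
  -- the empty sum when `m` exceeds `n`.
  ∑-drop : ∀ m n {f : ℕ → Carrier} → (∀ k → k ℕ.< m → f k ≈ 0#) →
    ∑< n f ≈ ∑< (n ∸ m) (λ k → f (m ℕ.+ k))
  ∑-drop zero    n       f≈0 = refl
  ∑-drop (suc m) zero    f≈0 = refl
  ∑-drop (suc m) (suc n) {f} f≈0 = begin
    f 0 + ∑< n (f ∘ suc)                    ≈⟨ +-congʳ (f≈0 0 z<s) ⟩
    0# + ∑< n (f ∘ suc)                     ≈⟨ +-identityˡ _ ⟩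
    ∑< n (f ∘ suc)                          ≈⟨ ∑-drop m n (λ k k<m → f≈0 (suc k) (s<s k<m)) ⟩
    ∑< (n ∸ m) (λ k → f (suc m ℕ.+ k))      ∎

  -- The length is written `n * 2`, not `2 * n`, because `suc n * 2` computes to two successors on
  -- top of `n * 2`, and the induction removes one even and one odd index at a time.
  ∑-parity : ∀ n (f : ℕ → Carrier) →
    ∑< (n ℕ.* 2) f ≈ ∑< n (λ k → f (k ℕ.* 2)) + ∑< n (λ k → f (suc (k ℕ.* 2)))
  ∑-parity zero    f = sym (+-identityˡ _)
  ∑-parity (suc n) f = begin
    f 0 + (f 1 + ∑< (n ℕ.* 2) f″)
      ≈⟨ +-congˡ (+-congˡ (∑-parity n f″)) ⟩
    f 0 + (f 1 + (∑< n (λ k → f″ (k ℕ.* 2)) + ∑< n (λ k → f″ (suc (k ℕ.* 2)))))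
      ≈⟨ solve 4 (λ a b c d → a :+ (b :+ (c :+ d)) := (a :+ c) :+ (b :+ d)) refl _ _ _ _ ⟩
    ∑< (suc n) (λ k → f (k ℕ.* 2)) + ∑< (suc n) (λ k → f (suc (k ℕ.* 2))) ∎
    where
    open SemiringSolver commutativeSemiring
    f″ = f ∘ suc ∘ suc

  -- Both sides run over the pairs with a ≤ m ≤ n and α k ≤ m; where α k > m
  -- the summand vanishes, so both extend to the same rectangle.
  ∑-triangle-swap : ∀ (α β : ℕ → ℕ) a n (f : ℕ → ℕ → Carrier) →
    (∀ k → a ℕ.≤ α k) →
    (∀ {i j} → i ℕ.≤ j → β i ℕ.≤ β j) →
    (∀ m k → β m ℕ.< k → m ℕ.< α k) →
    (∀ m k → m ℕ.< α k → f m k ≈ 0#) →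
    ∑[ a to n ] (λ m → ∑[ 0 to β m ] (f m)) ≈
    ∑[ 0 to β n ] (λ k → ∑[ α k to n ] (λ m → f m k))
  ∑-triangle-swap α β a n f a≤α β-mono β<⇒<α f≈0 = begin
    ∑[ a to n ] (λ m → ∑[ 0 to β m ] (f m))
      ≈⟨ sym (∑-drop a (suc n) λ m m<a → ∑-zero (suc (β m)) λ k _ →
           f≈0 m k (ℕₚ.<-≤-trans m<a (a≤α k))) ⟩
    ∑[ 0 to n ] (λ m → ∑[ 0 to β m ] (f m))
      ≈⟨ ∑-cong (suc n) (λ m m<1+n → sym (∑-truncate (s≤s (β-mono (ℕₚ.≤-pred m<1+n)))
           λ k β<k → f≈0 m k (β<⇒<α m k β<k))) ⟩
    ∑[ 0 to n ] (λ m → ∑[ 0 to β n ] (f m))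
      ≈⟨ ∑-swap (suc n) (suc (β n)) f ⟩
    ∑[ 0 to β n ] (λ k → ∑[ 0 to n ] (λ m → f m k))
      ≈⟨ ∑-cong (suc (β n)) (λ k _ → ∑-drop (α k) (suc n) (λ m m<α → f≈0 m k m<α)) ⟩
    ∑[ 0 to β n ] (λ k → ∑[ α k to n ] (λ m → f m k)) ∎

-- Formal power series and the derivation (1 + lam t) d/dt

module PowerSeries {c ℓ} (R : CommutativeRing c ℓ) where

  open CommutativeRing R hiding (zero; _-_)
  open RingOps rawRing using (_·_; ∑[_to_])
  open FiniteSums R
  open Multiples semiring using (×-homo-+)
  open SetoidReasoning setoid
  open SemiringSolver commutativeSemiring using (solve; _:+_; _:*_; _:=_)
  module T = RingOps (powerSeries rawRing)

  N : ℕ → Carrier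
  N n = n · 1#

  N-+ : ∀ m n → N (m ℕ.+ n) ≈ N m + N n
  N-+ = ×-homo-+ 1#

  -- Only two terms of the convolution survive when `g` is a linear polynomial. With `g` = x - n
  -- this becomes the recursion of the Stirling numbers.
  *-tail-zero : ∀ (f g : T.Carrier) → (∀ n → g (suc (suc n)) ≈ 0#) →
    ∀ n → (f T.* g) (suc n) ≈ f (suc n) * g 0 + f n * g 1
  *-tail-zero f g g≈0 n = begin
    (f T.* g) (suc n)
      ≈⟨ ∑-reverse (suc n) (λ k → f k * g (suc n ∸ k)) ⟩
    ∑[ 0 to suc n ] (λ k → f (suc n ∸ k) * g (suc n ∸ (suc n ∸ k)))
      ≈⟨ ∑-cong (suc (suc n)) {g = λ k → f (suc n ∸ k) * g k} (λ k k<2+n →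
           *-congˡ {f (suc n ∸ k)} (reflexive (≡.cong g (ℕₚ.m∸[m∸n]≡n (ℕₚ.≤-pred k<2+n))))) ⟩
    f (suc n) * g 0 + (f n * g 1 + ∑< n (λ k → f (n ∸ suc k) * g (suc (suc k))))
      ≈⟨ +-congˡ (+-congˡ (∑-zero n {λ k → f (n ∸ suc k) * g (suc (suc k))}
           λ k _ → trans (*-congˡ (g≈0 k)) (zeroʳ _))) ⟩
    f (suc n) * g 0 + (f n * g 1 + 0#)
      ≈⟨ +-congˡ (+-identityʳ _) ⟩
    f (suc n) * g 0 + f n * g 1 ∎

  module Derivation (lam : Carrier) where

    -- The two summands are the coefficients of f′ and of lam t f′ in degree `n`.
    Δ : T.Carrier → T.Carrier
    Δ f n = N (suc n) * f (suc n) + lam * (N n * f n)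

    module _ (f g : T.Carrier) where

      private
        -- The summands of (Ef · g)ₙ, (f · Eg)ₙ, (Df · g)ₙ and (f · Dg)ₙ, where
        -- D = d/dt and E = t D.
        Ef·g f·Eg Df·g f·Dg : ℕ → ℕ → Carrier
        Ef·g n k = (N k * f k) * g (n ∸ k)
        f·Eg n k = f k * (N (n ∸ k) * g (n ∸ k))
        Df·g n k = (N (suc k) * f (suc k)) * g (n ∸ k)
        f·Dg n k = f k * (N (suc (n ∸ k)) * g (suc (n ∸ k)))

        -- The operator t d/dt multiplies the coefficient of degree n by n, so its product rule is
        -- the splitting n = k + (n - k) in every summand of the convolution.
        euler : ∀ n → N n * (f T.* g) n ≈ ∑[ 0 to n ] (Ef·g n) + ∑[ 0 to n ] (f·Eg n)
        euler n = begin
          N n * (f T.* g) n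
            ≈⟨ ∑-*ˡ (suc n) (N n) (λ k → f k * g (n ∸ k)) ⟩
          ∑[ 0 to n ] (λ k → N n * (f k * g (n ∸ k)))
            ≈⟨ ∑-cong (suc n) {g = λ k → Ef·g n k + f·Eg n k} (λ k k<1+n → trans
                 (*-congʳ (trans (reflexive (≡.cong N (≡.sym (ℕₚ.m+[n∸m]≡n (ℕₚ.≤-pred k<1+n)))))
                                 (N-+ k (n ∸ k))))
                 (solve 4 (λ a b c d → (a :+ b) :* (c :* d) := (a :* c) :* d :+ c :* (b :* d))
                    refl (N k) (N (n ∸ k)) (f k) (g (n ∸ k)))) ⟩
          ∑[ 0 to n ] (λ k → Ef·g n k + f·Eg n k)
            ≈⟨ ∑-+ (suc n) (Ef·g n) (f·Eg n) ⟩
          ∑[ 0 to n ] (Ef·g n) + ∑[ 0 to n ] (f·Eg n) ∎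

        -- The product rule of d/dt is that of t d/dt one degree higher. The first sum loses its
        -- term k = 0 and the second its term k = n + 1, since both carry the factor `N 0`.
        euler-suc : ∀ n →
          N (suc n) * (f T.* g) (suc n) ≈ ∑[ 0 to n ] (Df·g n) + ∑[ 0 to n ] (f·Dg n)
        euler-suc n = trans (euler (suc n)) (+-cong
          (trans (+-congʳ (trans (*-congʳ (zeroˡ _)) (zeroˡ _))) (+-identityˡ _))
          (begin
            ∑[ 0 to suc n ] (f·Eg (suc n))
              ≈⟨ ∑-last (suc n) (f·Eg (suc n)) ⟩
            ∑[ 0 to n ] (f·Eg (suc n)) + f·Eg (suc n) (suc n)
              ≈⟨ +-congˡ (trans (*-congˡ (trans
                   (*-congʳ (reflexive (≡.cong N (ℕₚ.n∸n≡0 n)))) (zeroˡ _))) (zeroʳ _)) ⟩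
            ∑[ 0 to n ] (f·Eg (suc n)) + 0#
              ≈⟨ +-identityʳ _ ⟩
            ∑[ 0 to n ] (f·Eg (suc n))
              ≈⟨ ∑-cong (suc n) (λ k k<1+n → reflexive (≡.cong (λ j → f k * (N j * g j))
                   (ℕₚ.+-∸-assoc 1 (ℕₚ.≤-pred k<1+n)))) ⟩
            ∑[ 0 to n ] (f·Dg n) ∎))

      leibniz : ∀ n → Δ (f T.* g) n ≈ (Δ f T.* g) n + (f T.* Δ g) n
      leibniz n = begin
        N (suc n) * (f T.* g) (suc n) + lam * (N n * (f T.* g) n)
          ≈⟨ +-cong (euler-suc n) (*-congˡ (euler n)) ⟩
        (A + B) + lam * (A′ + B′)
          ≈⟨ solve 5 (λ a b a′ b′ l → (a :+ b) :+ l :* (a′ :+ b′) :=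
               (a :+ l :* a′) :+ (b :+ l :* b′)) refl A B A′ B′ lam ⟩
        (A + lam * A′) + (B + lam * B′)
          ≈⟨ +-cong (combine (Df·g n) (Ef·g n)) (combine (f·Dg n) (f·Eg n)) ⟩
        ∑[ 0 to n ] (λ k → Df·g n k + lam * Ef·g n k) +
        ∑[ 0 to n ] (λ k → f·Dg n k + lam * f·Eg n k)
          ≈⟨ +-cong
               (∑-cong (suc n) λ k _ → solve 4 (λ a l b g → a :* g :+ l :* (b :* g) :=
                  (a :+ l :* b) :* g) refl (N (suc k) * f (suc k)) lam (N k * f k) (g (n ∸ k)))
               (∑-cong (suc n) λ k _ → solve 4 (λ f a l b → f :* a :+ l :* (f :* b) :=
                  f :* (a :+ l :* b)) refl (f k) (N (suc (n ∸ k)) * g (suc (n ∸ k))) lam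
                  (N (n ∸ k) * g (n ∸ k))) ⟩
        (Δ f T.* g) n + (f T.* Δ g) n ∎
        where
        A  = ∑[ 0 to n ] (Df·g n)
        B  = ∑[ 0 to n ] (f·Dg n)
        A′ = ∑[ 0 to n ] (Ef·g n)
        B′ = ∑[ 0 to n ] (f·Eg n)
        combine : ∀ (u v : ℕ → Carrier) →
          ∑[ 0 to n ] u + lam * ∑[ 0 to n ] v ≈ ∑[ 0 to n ] (λ k → u k + lam * v k)
        combine u v = trans (+-congˡ (∑-*ˡ (suc n) lam v))
                            (sym (∑-+ (suc n) u (λ k → lam * v k)))

-- Ring homomorphisms, integer fractions and falling factorials

module Homomorphisms {a b ℓ₁ ℓ₂} {A : RawRing a ℓ₁} {B : RawRing b ℓ₂} where

  open RawRing A using () renaming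
    (Carrier to A₀; _≈_ to _≈ᴬ_; _+_ to _+ᴬ_; _*_ to _*ᴬ_; -_ to -ᴬ_; 0# to 0ᴬ; 1# to 1ᴬ)
  open RawRing B

  isRingHomomorphism : (h : A₀ → Carrier) →
    (∀ {x y} → x ≈ᴬ y → h x ≈ h y) →
    (∀ x y → h (x +ᴬ y) ≈ h x + h y) →
    (∀ x y → h (x *ᴬ y) ≈ h x * h y) →
    (∀ x → h (-ᴬ x) ≈ - h x) →
    h 0ᴬ ≈ 0# → h 1ᴬ ≈ 1# → IsRingHomomorphism A B h
  isRingHomomorphism h cong +-homo *-homo -‿homo 0#-homo 1#-homo = record
    { isSemiringHomomorphism = record
      { isNearSemiringHomomorphism = record
        { +-isMonoidHomomorphism = record
          { isMagmaHomomorphism = record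
            { isRelHomomorphism = record { cong = cong }
            ; homo = +-homo
            }
          ; ε-homo = 0#-homo
          }
        ; *-homo = *-homo
        }
      ; 1#-homo = 1#-homo
      }
    ; -‿homo = -‿homo
    }

-- Clearing denominators turns identities between fractions p / q of ℚ into
-- identities between integers.
module Fractions where

  private
    toℚᵘ-/1 : ∀ z → ℚ.toℚᵘ (z / 1) ℚᵘ.≃ mkℚᵘ z 0
    toℚᵘ-/1 z = ℚₚ.toℚᵘ-fromℚᵘ (mkℚᵘ z 0)

  /1-+ : ∀ z w → (z ℤ.+ w) / 1 ≡ (z / 1) ℚ.+ (w / 1)
  /1-+ z w = ℚₚ.toℚᵘ-injective (begin
    ℚ.toℚᵘ ((z ℤ.+ w) / 1)               ≈⟨ toℚᵘ-/1 (z ℤ.+ w) ⟩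
    mkℚᵘ (z ℤ.+ w) 0                     ≈⟨ *≡* (≡.cong (ℤ._* + 1)
                                              (≡.sym (≡.cong₂ ℤ._+_
                                                (ℤₚ.*-identityʳ z) (ℤₚ.*-identityʳ w)))) ⟩
    mkℚᵘ z 0 ℚᵘ.+ mkℚᵘ w 0               ≈⟨ ℚᵘₚ.≃-sym (ℚᵘₚ.+-cong (toℚᵘ-/1 z) (toℚᵘ-/1 w)) ⟩
    ℚ.toℚᵘ (z / 1) ℚᵘ.+ ℚ.toℚᵘ (w / 1)   ≈⟨ ℚᵘₚ.≃-sym (ℚₚ.toℚᵘ-homo-+ (z / 1) (w / 1)) ⟩
    ℚ.toℚᵘ ((z / 1) ℚ.+ (w / 1))         ∎)
    where open SetoidReasoning ℚᵘₚ.≃-setoid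

  /1-* : ∀ z w → (z ℤ.* w) / 1 ≡ (z / 1) ℚ.* (w / 1)
  /1-* z w = ℚₚ.toℚᵘ-injective (begin
    ℚ.toℚᵘ ((z ℤ.* w) / 1)               ≈⟨ toℚᵘ-/1 (z ℤ.* w) ⟩
    mkℚᵘ z 0 ℚᵘ.* mkℚᵘ w 0               ≈⟨ ℚᵘₚ.≃-sym (ℚᵘₚ.*-cong (toℚᵘ-/1 z) (toℚᵘ-/1 w)) ⟩
    ℚ.toℚᵘ (z / 1) ℚᵘ.* ℚ.toℚᵘ (w / 1)   ≈⟨ ℚᵘₚ.≃-sym (ℚₚ.toℚᵘ-homo-* (z / 1) (w / 1)) ⟩
    ℚ.toℚᵘ ((z / 1) ℚ.* (w / 1))         ∎)
    where open SetoidReasoning ℚᵘₚ.≃-setoid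

  /1-neg : ∀ z → (ℤ.- z) / 1 ≡ ℚ.- (z / 1)
  /1-neg z = ℚₚ.toℚᵘ-injective (begin
    ℚ.toℚᵘ ((ℤ.- z) / 1)     ≈⟨ toℚᵘ-/1 (ℤ.- z) ⟩
    ℚᵘ.- mkℚᵘ z 0            ≈⟨ ℚᵘₚ.≃-sym (ℚᵘₚ.-‿cong (toℚᵘ-/1 z)) ⟩
    ℚᵘ.- ℚ.toℚᵘ (z / 1)      ≈⟨ ℚᵘₚ.≃-sym (ℚₚ.toℚᵘ-homo‿- (z / 1)) ⟩
    ℚ.toℚᵘ (ℚ.- (z / 1))     ∎)
    where open SetoidReasoning ℚᵘₚ.≃-setoid

  /1-isRingHomomorphism : IsRingHomomorphism ℤ.+-*-rawRing ℚ.+-*-rawRing (λ z → z / 1)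
  /1-isRingHomomorphism = Homomorphisms.isRingHomomorphism (λ z → z / 1)
    (≡.cong (λ z → z / 1)) /1-+ /1-* /1-neg ≡.refl ≡.refl

  cancel-factor : ∀ m n .{{_ : ℕ.NonZero n}} .{{_ : ℕ.NonZero (m ℕ.* n)}} →
    (+ m / 1) ℚ.* (+ 1 / (m ℕ.* n)) ≡ + 1 / n
  cancel-factor m@(suc _) n@(suc _) = ℚₚ.toℚᵘ-injective (begin
    ℚ.toℚᵘ ((+ m / 1) ℚ.* (+ 1 / (m ℕ.* n)))
      ≈⟨ ℚₚ.toℚᵘ-homo-* (+ m / 1) (+ 1 / (m ℕ.* n)) ⟩
    ℚ.toℚᵘ (+ m / 1) ℚᵘ.* ℚ.toℚᵘ (+ 1 / (m ℕ.* n))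
      ≈⟨ ℚᵘₚ.*-cong (toℚᵘ-/1 (+ m)) (ℚₚ.toℚᵘ-fromℚᵘ (mkℚᵘ (+ 1) (ℕ.pred (m ℕ.* n)))) ⟩
    mkℚᵘ (+ m) 0 ℚᵘ.* mkℚᵘ (+ 1) (ℕ.pred (m ℕ.* n))
      ≈⟨ *≡* (≡.cong +_ (≡.trans (≡.cong (ℕ._* n) (ℕₚ.*-identityʳ m))
           (≡.sym (≡.trans (ℕₚ.+-identityʳ _) (ℕₚ.+-identityʳ _))))) ⟩
    mkℚᵘ (+ 1) (ℕ.pred n)
      ≈⟨ ℚᵘₚ.≃-sym (ℚₚ.toℚᵘ-fromℚᵘ (mkℚᵘ (+ 1) (ℕ.pred n))) ⟩
    ℚ.toℚᵘ (+ 1 / n) ∎)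
    where open SetoidReasoning ℚᵘₚ.≃-setoid

  inverse : ∀ n → (+ suc n / 1) ℚ.* (+ 1 / suc n) ≡ 1ℚ
  inverse n = ≡.trans (≡.cong ((+ suc n / 1) ℚ.*_)
    (≡.sym (ℚₚ./-cong {p₁ = + 1} ≡.refl (ℕₚ.*-identityʳ (suc n)))))
    (cancel-factor (suc n) 1)

module Preservation {a b ℓ₁ ℓ₂} {A : RawRing a ℓ₁} (B : CommutativeRing b ℓ₂)
  {h : RawRing.Carrier A → CommutativeRing.Carrier B}
  (hom : IsRingHomomorphism A (CommutativeRing.rawRing B) h) where

  private module A = RingOps A
  open CommutativeRing B hiding (zero; _-_)
  open RingOps rawRing using (_·_; _^_; fallingFactorial)
  open FiniteSums B
  open IsRingHomomorphism hom

  ·-homo : ∀ n x → h (n A.· x) ≈ n · h x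
  ·-homo zero    x = 0#-homo
  ·-homo (suc n) x = trans (+-homo _ _) (+-congˡ (·-homo n x))

  ^-homo : ∀ x n → h (x A.^ n) ≈ h x ^ n
  ^-homo x zero    = 1#-homo
  ^-homo x (suc n) = trans (*-homo _ _) (*-congˡ (^-homo x n))

  ∑-homo : ∀ n (f : ℕ → A.Carrier) → h (A.∑[ 0 to n ] f) ≈ ∑< (suc n) (h ∘ f)
  ∑-homo n = go (suc n)
    where
    go : ∀ n (f : ℕ → A.Carrier) → h (A.sum {n} (λ i → f (toℕ i))) ≈ ∑< n (h ∘ f)
    go zero    f = 0#-homo
    go (suc n) f = trans (+-homo _ _) (+-congˡ (go n (f ∘ suc)))

  fallingFactorial-homo : ∀ l x n →
    h (A.fallingFactorial l x n) ≈ fallingFactorial (h l) (h x) n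
  fallingFactorial-homo l x zero    = 1#-homo
  fallingFactorial-homo l x (suc n) = trans (*-homo _ _) (*-cong (fallingFactorial-homo l x n)
    (trans (+-homo _ _) (+-congˡ (trans (-‿homo _) (-‿cong (·-homo n l))))))

module FallingFactorials {c ℓ} (R : CommutativeRing c ℓ) where

  open CommutativeRing R hiding (zero; _-_)
  open RingOps rawRing using (fallingFactorial)
  open Multiples semiring using (×-congʳ)

  fallingFactorial-cong : ∀ {l m x y} → l ≈ m → x ≈ y →
    ∀ n → fallingFactorial l x n ≈ fallingFactorial m y n
  fallingFactorial-cong l≈m x≈y zero    = refl
  fallingFactorial-cong l≈m x≈y (suc n) =
    *-cong (fallingFactorial-cong l≈m x≈y n) (+-cong x≈y (-‿cong (×-congʳ n l≈m)))

-- Substitution into a series and its behaviour under Δ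

module Substitution {c ℓ} (R : CommutativeRing c ℓ) where

  open CommutativeRing R hiding (zero; _-_)
  open RingOps rawRing using (_^_; ∑[_to_])
  open Series rawRing using (X; _∙_) renaming (_∘_ to _⟨_⟩)
  open FiniteSums R
  open PowerSeries R
  open SetoidReasoning setoid
  open SemiringSolver commutativeSemiring using (solve; _:+_; _:*_; _:=_)

  -- Induction on k: in the convolution of g with gᵏ the term i = 0 is killed by the constant
  -- coefficient of g, and a term with i > 0 evaluates gᵏ in a degree below k.
  ^-low : ∀ (g : T.Carrier) → g 0 ≈ 0# → ∀ k n → n ℕ.< k → (g T.^ k) n ≈ 0#
  ^-low g g₀≈0 (suc k) n (s≤s n≤k) =
    ∑-zero (suc n) {λ i → g i * (g T.^ k) (n ∸ i)} (λ i → term i n n≤k)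
    where
    term : ∀ i n → n ℕ.≤ k → i ℕ.< suc n → g i * (g T.^ k) (n ∸ i) ≈ 0#
    term zero    n       _     _   = trans (*-congʳ g₀≈0) (zeroˡ _)
    term (suc i) zero    _     (s≤s ())
    term (suc i) (suc n) n<k   _   =
      trans (*-congˡ (^-low g g₀≈0 k (n ∸ i) (ℕₚ.≤-<-trans (ℕₚ.m∸n≤m n i) n<k))) (zeroʳ _)

  *-constant : ∀ {c} (f h : T.Carrier) → f 0 ≈ c → (∀ n → f (suc n) ≈ 0#) →
    ∀ n → (f T.* h) n ≈ c * h n
  *-constant {c} f h f₀≈c f₊≈0 n = begin
    f 0 * h n + ∑< n (λ k → f (suc k) * h (n ∸ suc k))
      ≈⟨ +-cong (*-congʳ f₀≈c) (∑-zero n {λ k → f (suc k) * h (n ∸ suc k)}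
           λ k _ → trans (*-congʳ (f₊≈0 k)) (zeroˡ _)) ⟩
    c * h n + 0#   ≈⟨ +-identityʳ _ ⟩
    c * h n        ∎

  module _ (lam : Carrier) where

    open Derivation lam

    Δ-1 : ∀ n → Δ T.1# n ≈ 0#
    Δ-1 zero    = trans (+-cong (zeroʳ _) (trans (*-congˡ (zeroˡ _)) (zeroʳ _))) (+-identityˡ _)
    Δ-1 (suc n) = trans (+-cong (zeroʳ _) (trans (*-congˡ (zeroʳ _)) (zeroʳ _))) (+-identityˡ _)

    module _ {c : Carrier} (g : T.Carrier) (g₀≈0 : g 0 ≈ 0#)
             (Δg₀≈c : Δ g 0 ≈ c) (Δg₊≈0 : ∀ n → Δ g (suc n) ≈ 0#) where

      private
        -- Proved together with `Δ-^`. Keeping the extra factor g turns the rule Δ gᵏ = k c gᵏ⁻¹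
        -- into one that makes sense for k = 0, and g · Δ gᵏ is exactly what Leibniz' rule leaves
        -- over for gᵏ⁺¹.
        *-Δ-^ : ∀ k n → (g T.* Δ (g T.^ k)) n ≈ N k * (c * (g T.^ k) n)
      Δ-^ : ∀ k n → Δ (g T.^ suc k) n ≈ N (suc k) * (c * (g T.^ k) n)

      *-Δ-^ zero    n = trans
        (∑-zero (suc n) {λ i → g i * Δ T.1# (n ∸ i)} λ i _ → trans (*-congˡ (Δ-1 (n ∸ i))) (zeroʳ _))
        (sym (zeroˡ _))
      *-Δ-^ (suc k) n = begin
        ∑[ 0 to n ] (λ i → g i * Δ (g T.^ suc k) (n ∸ i))
          ≈⟨ ∑-cong (suc n) (λ i _ → trans (*-congˡ (Δ-^ k (n ∸ i)))
               (solve 4 (λ a b c d → a :* (b :* (c :* d)) := (b :* c) :* (a :* d)) refl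
                  (g i) (N (suc k)) c ((g T.^ k) (n ∸ i)))) ⟩
        ∑[ 0 to n ] (λ i → (N (suc k) * c) * (g i * (g T.^ k) (n ∸ i)))
          ≈⟨ sym (∑-*ˡ (suc n) (N (suc k) * c) (λ i → g i * (g T.^ k) (n ∸ i))) ⟩
        (N (suc k) * c) * (g T.^ suc k) n
          ≈⟨ *-assoc _ _ _ ⟩
        N (suc k) * (c * (g T.^ suc k) n) ∎

      Δ-^ k n = begin
        Δ (g T.^ suc k) n
          ≈⟨ leibniz g (g T.^ k) n ⟩
        (Δ g T.* g T.^ k) n + (g T.* Δ (g T.^ k)) n
          ≈⟨ +-cong (*-constant (Δ g) (g T.^ k) Δg₀≈c Δg₊≈0 n) (*-Δ-^ k n) ⟩
        c * (g T.^ k) n + N k * (c * (g T.^ k) n)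
          ≈⟨ +-congʳ (sym (*-identityˡ _)) ⟩
        1# * (c * (g T.^ k) n) + N k * (c * (g T.^ k) n)
          ≈⟨ sym (distribʳ _ _ _) ⟩
        N (suc k) * (c * (g T.^ k) n) ∎

      -- Applied termwise, Δ turns gᵏ⁺¹ into (k + 1) c gᵏ; the factor k + 1 is absorbed by the
      -- coefficient of `e`, and the sum shifts down by one place.
      Δ-exp : ∀ (e : T.Carrier) → (∀ k → N (suc k) * e (suc k) ≈ e k) →
        ∀ n → Δ (e ⟨ g ⟩) n ≈ c * (e ⟨ g ⟩) n
      Δ-exp e e′≈e n = begin
        N (suc n) * (e ⟨ g ⟩) (suc n) + lam * (N n * (e ⟨ g ⟩) n)
          ≈⟨ +-cong (∑-*ˡ (suc (suc n)) _ (u (suc n))) (trans (*-congˡ (trans (*-congˡ extend)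
               (∑-*ˡ (suc (suc n)) (N n) (u n)))) (∑-*ˡ (suc (suc n)) lam (λ k → N n * u n k))) ⟩
        ∑[ 0 to suc n ] (λ k → N (suc n) * u (suc n) k) +
        ∑[ 0 to suc n ] (λ k → lam * (N n * u n k))
          ≈⟨ sym (∑-+ (suc (suc n)) (λ k → N (suc n) * u (suc n) k) (λ k → lam * (N n * u n k))) ⟩
        ∑[ 0 to suc n ] (λ k → N (suc n) * u (suc n) k + lam * (N n * u n k))
          ≈⟨ ∑-cong (suc (suc n)) {g = λ k → e k * Δ (g T.^ k) n} (λ k _ →
               solve 6 (λ N₁ e p₁ l N₀ p₀ → N₁ :* (e :* p₁) :+ l :* (N₀ :* (e :* p₀)) :=
                 e :* (N₁ :* p₁ :+ l :* (N₀ :* p₀))) refl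
                 (N (suc n)) (e k) ((g T.^ k) (suc n)) lam (N n) ((g T.^ k) n)) ⟩
        e 0 * Δ T.1# n + ∑[ 0 to n ] (λ k → e (suc k) * Δ (g T.^ suc k) n)
          ≈⟨ +-cong (trans (*-congˡ (Δ-1 n)) (zeroʳ _)) (∑-cong (suc n) λ k _ → begin
               e (suc k) * Δ (g T.^ suc k) n
                 ≈⟨ *-congˡ (Δ-^ k n) ⟩
               e (suc k) * (N (suc k) * (c * (g T.^ k) n))
                 ≈⟨ solve 4 (λ e N c p → e :* (N :* (c :* p)) := c :* ((N :* e) :* p)) refl
                      (e (suc k)) (N (suc k)) c ((g T.^ k) n) ⟩
               c * ((N (suc k) * e (suc k)) * (g T.^ k) n)
                 ≈⟨ *-congˡ (*-congʳ (e′≈e k)) ⟩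
               c * u n k ∎) ⟩
        0# + ∑[ 0 to n ] (λ k → c * u n k)
          ≈⟨ +-identityˡ _ ⟩
        ∑[ 0 to n ] (λ k → c * u n k)
          ≈⟨ sym (∑-*ˡ (suc n) c (u n)) ⟩
        c * (e ⟨ g ⟩) n ∎
        where
        u : ℕ → ℕ → Carrier
        u n k = e k * (g T.^ k) n
        -- Δ involves the degrees n and n + 1, whose compositions are cut off at different k. The
        -- additional power gⁿ⁺¹ has no term of degree n.
        extend : (e ⟨ g ⟩) n ≈ ∑[ 0 to suc n ] (u n)
        extend = sym (trans (∑-last (suc n) (u n)) (trans
          (+-congˡ (trans (*-congˡ (^-low g g₀≈0 (suc n) n (ℕₚ.n<1+n n))) (zeroʳ _)))
          (+-identityʳ _)))

    private
      lamX-* : ∀ (h : T.Carrier) n → ((lam ∙ X) T.* h) (suc n) ≈ lam * h n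
      lamX-* h n = begin
        (lam * 0#) * h (suc n) + ((lam * 1#) * h n +
          ∑< n (λ k → (lam * 0#) * h (n ∸ suc k)))
          ≈⟨ +-cong (vanish _) (+-cong (*-congʳ (*-identityʳ _))
               (∑-zero n {λ k → (lam * 0#) * h (n ∸ suc k)} λ k _ → vanish _)) ⟩
        0# + (lam * h n + 0#)
          ≈⟨ trans (+-identityˡ _) (+-identityʳ _) ⟩
        lam * h n ∎
        where
        vanish : ∀ x → (lam * 0#) * x ≈ 0#
        vanish x = trans (*-congʳ (zeroʳ _)) (zeroˡ _)

      lamX-^-high : ∀ k n → k ℕ.< n → ((lam ∙ X) T.^ k) n ≈ 0#
      lamX-^-high zero    (suc n) _         = refl
      lamX-^-high (suc k) (suc n) (s≤s k<n) =
        trans (lamX-* ((lam ∙ X) T.^ k) n) (trans (*-congˡ (lamX-^-high k n k<n)) (zeroʳ _))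

      lamX-^-diagonal : ∀ k → ((lam ∙ X) T.^ k) k ≈ lam ^ k
      lamX-^-diagonal zero    = refl
      lamX-^-diagonal (suc k) =
        trans (lamX-* ((lam ∙ X) T.^ k) k) (*-congˡ (lamX-^-diagonal k))

    -- The k-th power of lam t has the single coefficient lamᵏ in degree k, so of the cut-off sum
    -- only the last summand remains.
    scaling : ∀ (f : T.Carrier) n → (f ⟨ lam ∙ X ⟩) n ≈ f n * lam ^ n
    scaling f n = begin
      (f ⟨ lam ∙ X ⟩) n
        ≈⟨ ∑-last n u ⟩
      ∑< n u + u n
        ≈⟨ +-cong (∑-zero n {u} λ k k<n → trans (*-congˡ (lamX-^-high k n k<n)) (zeroʳ _))
                  (*-congˡ (lamX-^-diagonal n)) ⟩
      0# + f n * lam ^ n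
        ≈⟨ +-identityˡ _ ⟩
      f n * lam ^ n ∎
      where
      u : ℕ → Carrier
      u k = f k * ((lam ∙ X) T.^ k) n

-- Coefficients of the binomial series (1 + lam t)ᵃ

module BinomialSeries {c ℓ} (R : CommutativeRing c ℓ) {ι : ℚ → CommutativeRing.Carrier R}
  (ι-hom : IsRingHomomorphism ℚ.+-*-rawRing (CommutativeRing.rawRing R) ι) where

  open CommutativeRing R hiding (zero; _-_)
  open RingOps rawRing using (_·_; _^_; fallingFactorial; _-_)
  open Series rawRing using (X; _∙_; module Exp) renaming (_∘_ to _⟨_⟩)
  open Exp ι
  open PowerSeries R
  open Substitution R
  open SetoidReasoning setoid
  open RingProperties ring using (-1*x≈-x)
  open Multiples semiring using (×-assoc-*)
  open SemiringSolver commutativeSemiring using (solve; _:+_; _:*_; _:=_)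
  private module ι = IsRingHomomorphism ι-hom

  ι-/1 : ∀ n → ι (+ n / 1) ≈ N n
  ι-/1 zero    = ι.0#-homo
  ι-/1 (suc n) = trans (ι.⟦⟧-cong (Fractions./1-+ (+ 1) (+ n)))
    (trans (ι.+-homo _ _) (+-cong ι.1#-homo (ι-/1 n)))

  ι-/1-* : ∀ m n → ι (+ (m ℕ.* n) / 1) ≈ ι (+ m / 1) * ι (+ n / 1)
  ι-/1-* m n = trans (ι.⟦⟧-cong (≡.trans (≡.cong (_/ 1) (ℤₚ.pos-* m n)) (Fractions./1-* (+ m) (+ n))))
    (ι.*-homo _ _)

  -- Taken as the image of a rational, unlike `N (n !)`, to agree with the factor that `egfCoeff`
  -- multiplies by.
  factorial : ℕ → Carrier
  factorial n = ι (+ (n !) / 1)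

  factorial-suc : ∀ n → factorial (suc n) ≈ N (suc n) * factorial n
  factorial-suc n = trans (ι-/1-* (suc n) (n !)) (*-congʳ (ι-/1 (suc n)))

  N-cancel : ∀ m n .{{_ : ℕ.NonZero n}} .{{_ : ℕ.NonZero (suc m ℕ.* n)}} →
    N (suc m) * ι (+ 1 / (suc m ℕ.* n)) ≈ ι (+ 1 / n)
  N-cancel m n = trans (*-congʳ (sym (ι-/1 (suc m)))) (trans (sym (ι.*-homo _ _))
    (ι.⟦⟧-cong (Fractions.cancel-factor (suc m) n)))

  -- `(suc k) !` computes to `suc k * k !`, so one factor of the denominator cancels. This is all
  -- that `Δ-exp` asks of the exponential series.
  exp-derivative : ∀ k → N (suc k) * exp (suc k) ≈ exp k
  exp-derivative k = N-cancel k (k !) {{k ℕₚ.!≢0}} {{suc k ℕₚ.!≢0}}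

  N-inverse : ∀ k → N (suc k) * ι (+ 1 / suc k) ≈ 1#
  N-inverse k = trans (*-congʳ (sym (ι-/1 (suc k)))) (trans (sym (ι.*-homo _ _))
    (trans (ι.⟦⟧-cong (Fractions.inverse k)) ι.1#-homo))

  module _ (lam a : Carrier) where

    open Derivation lam

    private
      L : T.Carrier
      L = log1+ ⟨ lam ∙ X ⟩

      -- The factor `suc n` cancels the denominator in the logarithm, and the derivative of `L`
      -- becomes the geometric series of lam / (1 + lam t) with ratio -lam. Hence consecutive terms
      -- cancel in Δ L beyond degree 0.
      N*L : ∀ n → N (suc n) * L (suc n) ≈ (- 1#) ^ n * lam ^ suc n
      N*L n = begin
        N (suc n) * L (suc n)
          ≈⟨ *-congˡ (scaling lam log1+ (suc n)) ⟩
        N (suc n) * (((- 1#) ^ n * ι (+ 1 / suc n)) * lam ^ suc n)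
          ≈⟨ solve 4 (λ N s i l → N :* ((s :* i) :* l) := (N :* i) :* (s :* l)) refl _ _ _ _ ⟩
        (N (suc n) * ι (+ 1 / suc n)) * ((- 1#) ^ n * lam ^ suc n)
          ≈⟨ trans (*-congʳ (N-inverse n)) (*-identityˡ _) ⟩
        (- 1#) ^ n * lam ^ suc n ∎

      ΔL-0 : Δ L 0 ≈ lam
      ΔL-0 = begin
        N 1 * L 1 + lam * (0# * L 0)
          ≈⟨ +-cong (N*L 0) (trans (*-congˡ (zeroˡ _)) (zeroʳ _)) ⟩
        1# * (lam * 1#) + 0#
          ≈⟨ trans (+-identityʳ _) (trans (*-identityˡ _) (*-identityʳ _)) ⟩
        lam ∎

      ΔL-suc : ∀ n → Δ L (suc n) ≈ 0#
      ΔL-suc n = begin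
        N (suc (suc n)) * L (suc (suc n)) + lam * (N (suc n) * L (suc n))
          ≈⟨ +-cong (N*L (suc n)) (*-congˡ (N*L n)) ⟩
        (- 1# * s) * (lam * p) + lam * (s * p)
          ≈⟨ solve 4 (λ m s l p → (m :* s) :* (l :* p) :+ l :* (s :* p) :=
               m :* (l :* (s :* p)) :+ l :* (s :* p)) refl (- 1#) s lam p ⟩
        - 1# * (lam * (s * p)) + lam * (s * p)
          ≈⟨ +-congʳ (-1*x≈-x _) ⟩
        - (lam * (s * p)) + lam * (s * p)
          ≈⟨ -‿inverseˡ _ ⟩
        0# ∎
        where
        s = (- 1#) ^ n
        p = lam ^ suc n

      Δ-∙ : ∀ (f : T.Carrier) n → Δ (a ∙ f) n ≈ a * Δ f n
      Δ-∙ f n = solve 6 (λ N₁ a f₁ l N₀ f₀ → N₁ :* (a :* f₁) :+ l :* (N₀ :* (a :* f₀)) :=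
        a :* (N₁ :* f₁ :+ l :* (N₀ :* f₀))) refl (N (suc n)) a (f (suc n)) lam (N n) (f n)

      aL₀≈0 : (a ∙ L) 0 ≈ 0#
      aL₀≈0 = trans (*-congˡ (trans (scaling lam log1+ 0) (zeroˡ _))) (zeroʳ _)

      Δ-power1+ : ∀ n → Δ (power1+ lam a) n ≈ (a * lam) * power1+ lam a n
      Δ-power1+ = Δ-exp lam (a ∙ L) aL₀≈0
        (trans (Δ-∙ L 0) (*-congˡ ΔL-0))
        (λ n → trans (Δ-∙ L (suc n)) (trans (*-congˡ (ΔL-suc n)) (zeroʳ _)))
        exp exp-derivative

    -- Induction on n through the recursion that Δ P = c P gives for the coefficients. The product
    -- of `a` and `lam` is a separate `c`, so that for an exponent z / lam the result is directly a
    -- falling factorial of z.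
    factorial*power1+ : ∀ {c} → a * lam ≈ c →
      ∀ n → factorial n * power1+ lam a n ≈ fallingFactorial lam c n
    factorial*power1+ a*lam≈c zero = begin
      factorial 0 * (exp 0 * 1# + 0#)
        ≈⟨ *-cong ι.1#-homo (trans (+-identityʳ _) (trans (*-identityʳ _) ι.1#-homo)) ⟩
      1# * 1#
        ≈⟨ *-identityˡ _ ⟩
      1# ∎
    factorial*power1+ {c} a*lam≈c (suc n) = begin
      factorial (suc n) * P (suc n)
        ≈⟨ *-congʳ (factorial-suc n) ⟩
      (N (suc n) * factorial n) * P (suc n)
        ≈⟨ solve 3 (λ a b c → (a :* b) :* c := b :* (a :* c)) refl _ _ _ ⟩
      factorial n * (N (suc n) * P (suc n))
        ≈⟨ *-congˡ recursion ⟩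
      factorial n * (P n * (c - n · lam))
        ≈⟨ sym (*-assoc _ _ _) ⟩
      (factorial n * P n) * (c - n · lam)
        ≈⟨ *-congʳ (factorial*power1+ a*lam≈c n) ⟩
      fallingFactorial lam c (suc n) ∎
      where
      P = power1+ lam a
      n·lam : lam * (N n * P n) ≈ (n · lam) * P n
      n·lam = begin
        lam * (N n * P n)      ≈⟨ solve 3 (λ l N p → l :* (N :* p) := (N :* l) :* p) refl _ _ _ ⟩
        (N n * lam) * P n      ≈⟨ *-congʳ (trans (×-assoc-* n 1# lam)
                                    (Multiples.×-congʳ semiring n (*-identityˡ lam))) ⟩
        (n · lam) * P n        ∎
      recursion : N (suc n) * P (suc n) ≈ P n * (c - n · lam)
      recursion = begin
        N (suc n) * P (suc n)
          ≈⟨ sym (trans (+-assoc _ _ _) (trans (+-congˡ (-‿inverseʳ _)) (+-identityʳ _))) ⟩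
        Δ P n - lam * (N n * P n)
          ≈⟨ +-cong (trans (Δ-power1+ n) (*-congʳ a*lam≈c)) (-‿cong n·lam) ⟩
        c * P n - (n · lam) * P n
          ≈⟨ sym (RingProperties.[y-z]x≈yx-zx ring (P n) c (n · lam)) ⟩
        (c - n · lam) * P n
          ≈⟨ *-comm _ _ ⟩
        P n * (c - n · lam) ∎

-- Stirling numbers of the first kind and the expansion of falling factorials

module Stirling where

  open PowerSeries ℤₚ.+-*-commutativeRing using (module T; *-tail-zero)
  open RingOps ℤ.+-*-rawRing using (_·_)
  open Series ℤ.+-*-rawRing using (X)

  private
    factor : ℕ → ℕ → ℤ
    factor n = X T.- n T.· T.1#

    ·1-0 : ∀ n → (n T.· T.1#) 0 ≡ n · + 1
    ·1-0 zero    = ≡.refl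
    ·1-0 (suc n) = ≡.cong (ℤ._+_ (+ 1)) (·1-0 n)

    ·1-suc : ∀ n j → (n T.· T.1#) (suc j) ≡ + 0
    ·1-suc zero    j = ≡.refl
    ·1-suc (suc n) j = ≡.trans (ℤₚ.+-identityˡ _) (·1-suc n j)

    factor-0 : ∀ n → factor n 0 ≡ ℤ.- (n · + 1)
    factor-0 n = ≡.trans (ℤₚ.+-identityˡ _) (≡.cong ℤ.-_ (·1-0 n))

    factor-1 : ∀ n → factor n 1 ≡ + 1
    factor-1 n = ≡.cong (λ z → + 1 ℤ.+ ℤ.- z) (·1-suc n 0)

    factor-2+ : ∀ n j → factor n (suc (suc j)) ≡ + 0
    factor-2+ n j = ≡.cong (λ z → + 0 ℤ.+ ℤ.- z) (·1-suc n (suc j))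

  S¹-suc-0 : ∀ n → S¹ (suc n) 0 ≡ S¹ n 0 ℤ.* (ℤ.- (n · + 1))
  S¹-suc-0 n = ≡.trans (ℤₚ.+-identityʳ _) (≡.cong (S¹ n 0 ℤ.*_) (factor-0 n))

  S¹-suc-suc : ∀ n l → S¹ (suc n) (suc l) ≡ S¹ n (suc l) ℤ.* (ℤ.- (n · + 1)) ℤ.+ S¹ n l
  S¹-suc-suc n l = ≡.trans (*-tail-zero (S¹ n) (factor n) (factor-2+ n) l) (≡.cong₂ ℤ._+_
    (≡.cong (S¹ n (suc l) ℤ.*_) (factor-0 n))
    (≡.trans (≡.cong (S¹ n l ℤ.*_) (factor-1 n)) (ℤₚ.*-identityʳ (S¹ n l))))

  S¹-high : ∀ n l → n ℕ.< l → S¹ n l ≡ + 0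
  S¹-high zero    (suc l) _         = ≡.refl
  S¹-high (suc n) (suc l) (s≤s n<l) = ≡.trans (S¹-suc-suc n l) (≡.cong₂ ℤ._+_
    (≡.cong (ℤ._* (ℤ.- (n · + 1))) (S¹-high n (suc l) (ℕₚ.m<n⇒m<1+n n<l))) (S¹-high n l n<l))

module StirlingExpansion {c ℓ} (R : CommutativeRing c ℓ) {φ : ℤ → CommutativeRing.Carrier R}
  (φ-hom : IsRingHomomorphism ℤ.+-*-rawRing (CommutativeRing.rawRing R) φ) where

  open CommutativeRing R hiding (zero; _-_)
  open RingOps rawRing using (_·_; _^_; ∑[_to_]; fallingFactorial; _-_)
  open FiniteSums R
  open Stirling
  open SetoidReasoning setoid
  open RingProperties ring using (-‿distribˡ-*)
  open Multiples semiring using (×-assoc-*; ×-congʳ)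
  open SemiringSolver commutativeSemiring using (solve; _:+_; _:*_; _:=_)
  private module φ = IsRingHomomorphism φ-hom
  private module ℤ· = RingOps ℤ.+-*-rawRing

  φ-S¹-high : ∀ n l → n ℕ.< l → φ (S¹ n l) ≈ 0#
  φ-S¹-high n l n<l = trans (φ.⟦⟧-cong (S¹-high n l n<l)) φ.0#-homo

  module _ (lam z : Carrier) where

    -- The falling factorial of z with step lam is homogeneous of degree n in z and lam, which
    -- explains the power of lam and avoids expanding in z / lam. For l > n the truncated exponent
    -- is harmless, as `S¹ n l` is zero.
    stirlingTerm : ℕ → ℕ → Carrier
    stirlingTerm n l = φ (S¹ n l) * lam ^ (n ∸ l) * z ^ l

    stirlingTerm-high : ∀ n l → n ℕ.< l → stirlingTerm n l ≈ 0#
    stirlingTerm-high n l n<l =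
      trans (*-congʳ (trans (*-congʳ (φ-S¹-high n l n<l)) (zeroˡ _))) (zeroˡ _)

    private
      t = stirlingTerm

      ν d : ℕ → Carrier
      ν n = φ (ℤ.- (n ℤ·.· + 1))
      d n = - (n · lam)

      ν*lam : ∀ n → ν n * lam ≈ d n
      ν*lam n = begin
        ν n * lam
          ≈⟨ *-congʳ (trans (φ.-‿homo _) (-‿cong (trans (Preservation.·-homo R φ-hom n (+ 1))
               (×-congʳ n φ.1#-homo)))) ⟩
        - (n · 1#) * lam
          ≈⟨ sym (-‿distribˡ-* _ _) ⟩
        - ((n · 1#) * lam)
          ≈⟨ -‿cong (trans (×-assoc-* n 1# lam) (×-congʳ n (*-identityˡ lam))) ⟩
        d n ∎

      t-suc-0 : ∀ n → t (suc n) 0 ≈ t n 0 * d n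
      t-suc-0 n = begin
        φ (S¹ (suc n) 0) * (lam * lam ^ n) * 1#
          ≈⟨ *-congʳ (*-congʳ (trans (φ.⟦⟧-cong (S¹-suc-0 n)) (φ.*-homo _ _))) ⟩
        φ (S¹ n 0) * ν n * (lam * lam ^ n) * 1#
          ≈⟨ solve 5 (λ s ν l p o → s :* ν :* (l :* p) :* o := s :* p :* o :* (ν :* l)) refl
               (φ (S¹ n 0)) (ν n) lam (lam ^ n) 1# ⟩
        t n 0 * (ν n * lam)
          ≈⟨ *-congˡ (ν*lam n) ⟩
        t n 0 * d n ∎

      -- One factor lam is split off and joins the integer -n to form -(n lam). For l = n the
      -- truncated exponent is 0 on both sides and nothing can be split off, but there
      -- `S¹ n (suc n)` vanishes.
      lower : ∀ n l → l ℕ.≤ n → φ (S¹ n (suc l)) * ν n * lam ^ (n ∸ l) * z ^ suc l ≈ t n (suc l) * d n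
      lower n l l≤n with ℕₚ.m≤n⇒m<n∨m≡n l≤n
      ... | inj₂ ≡.refl = trans
        (trans (*-congʳ (trans (*-congʳ (trans (*-congʳ S≈0) (zeroˡ _))) (zeroˡ _))) (zeroˡ _))
        (sym (trans (*-congʳ (stirlingTerm-high n (suc n) (ℕₚ.n<1+n n))) (zeroˡ _)))
        where S≈0 = φ-S¹-high n (suc n) (ℕₚ.n<1+n n)
      ... | inj₁ l<n = begin
        φ (S¹ n (suc l)) * ν n * lam ^ (n ∸ l) * z ^ suc l
          ≈⟨ *-congʳ (*-congˡ (reflexive (≡.cong (lam ^_) (ℕₚ.+-∸-assoc 1 l<n)))) ⟩
        φ (S¹ n (suc l)) * ν n * (lam * lam ^ (n ∸ suc l)) * z ^ suc l
          ≈⟨ solve 5 (λ s ν l p o → s :* ν :* (l :* p) :* o := s :* p :* o :* (ν :* l)) refl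
               (φ (S¹ n (suc l))) (ν n) lam (lam ^ (n ∸ suc l)) (z ^ suc l) ⟩
        t n (suc l) * (ν n * lam)
          ≈⟨ *-congˡ (ν*lam n) ⟩
        t n (suc l) * d n ∎

      t-suc-suc : ∀ n l → l ℕ.≤ n → t (suc n) (suc l) ≈ t n (suc l) * d n + t n l * z
      t-suc-suc n l l≤n = begin
        φ (S¹ (suc n) (suc l)) * lam ^ (n ∸ l) * (z * z ^ l)
          ≈⟨ *-congʳ (*-congʳ (trans (φ.⟦⟧-cong (S¹-suc-suc n l))
               (trans (φ.+-homo _ _) (+-congʳ (φ.*-homo _ _))))) ⟩
        (φ (S¹ n (suc l)) * ν n + φ (S¹ n l)) * lam ^ (n ∸ l) * (z * z ^ l)
          ≈⟨ solve 5 (λ a s p z q → (a :+ s) :* p :* (z :* q) :=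
               a :* p :* (z :* q) :+ s :* p :* q :* z) refl
               (φ (S¹ n (suc l)) * ν n) (φ (S¹ n l)) (lam ^ (n ∸ l)) z (z ^ l) ⟩
        φ (S¹ n (suc l)) * ν n * lam ^ (n ∸ l) * z ^ suc l + t n l * z
          ≈⟨ +-congʳ (lower n l l≤n) ⟩
        t n (suc l) * d n + t n l * z ∎

    fallingFactorial-expansion : ∀ n →
      fallingFactorial lam z n ≈ ∑[ 0 to n ] (stirlingTerm n)
    fallingFactorial-expansion zero = sym (begin
      φ (+ 1) * 1# * 1# + 0#  ≈⟨ +-identityʳ _ ⟩
      φ (+ 1) * 1# * 1#       ≈⟨ trans (*-identityʳ _) (*-identityʳ _) ⟩
      φ (+ 1)                 ≈⟨ φ.1#-homo ⟩
      1#                      ∎)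
    fallingFactorial-expansion (suc n) = begin
      fallingFactorial lam z n * (z - n · lam)
        ≈⟨ *-congʳ (fallingFactorial-expansion n) ⟩
      ∑[ 0 to n ] (t n) * (z - n · lam)
        ≈⟨ trans (distribˡ _ _ _) (+-comm _ _) ⟩
      ∑[ 0 to n ] (t n) * d n + ∑[ 0 to n ] (t n) * z
        -- The zero term l = n + 1 is appended to the first sum only: once l = 0 is separated, its
        -- remaining terms run over the same range as the second sum, as the recursion requires.
        ≈⟨ +-congʳ (*-congʳ (sym (trans (∑-last (suc n) (t n))
             (trans (+-congˡ (stirlingTerm-high n (suc n) (ℕₚ.n<1+n n))) (+-identityʳ _))))) ⟩
      ∑[ 0 to suc n ] (t n) * d n + ∑[ 0 to n ] (t n) * z
        ≈⟨ +-cong (∑-*ʳ (suc (suc n)) (d n) (t n)) (∑-*ʳ (suc n) z (t n)) ⟩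
      (t n 0 * d n + ∑[ 0 to n ] (λ l → t n (suc l) * d n)) + ∑[ 0 to n ] (λ l → t n l * z)
        ≈⟨ trans (+-assoc _ _ _)
             (+-congˡ (sym (∑-+ (suc n) (λ l → t n (suc l) * d n) (λ l → t n l * z)))) ⟩
      t n 0 * d n + ∑[ 0 to n ] (λ l → t n (suc l) * d n + t n l * z)
        ≈⟨ sym (+-cong (t-suc-0 n) (∑-cong (suc n) λ l l<1+n → t-suc-suc n l (ℕₚ.≤-pred l<1+n))) ⟩
      ∑[ 0 to suc n ] (t (suc n)) ∎

-- Products of exponential generating functions

module ExponentialProduct {c ℓ} (R : CommutativeRing c ℓ) {ι : ℚ → CommutativeRing.Carrier R}
  (ι-hom : IsRingHomomorphism ℚ.+-*-rawRing (CommutativeRing.rawRing R) ι) where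

  open CommutativeRing R hiding (zero; _-_)
  open RingOps rawRing using (∑[_to_])
  open FiniteSums R
  open PowerSeries R using (module T)
  open BinomialSeries R ι-hom
  open SetoidReasoning setoid
  open SemiringSolver commutativeSemiring using (solve; _:*_; _:=_)

  private
    nCk*k!*[n∸k]! : ∀ {n k} → k ℕ.≤ n → (n C k) ℕ.* (k ! ℕ.* (n ∸ k) !) ≡ n !
    nCk*k!*[n∸k]! {n} {k} k≤n = ≡.trans (≡.cong (ℕ._* (k ! ℕ.* (n ∸ k) !)) (nCk≡n!/k![n-k]! k≤n))
      (m/n*n≡m {{k !* (n ∸ k) !≢0}} (k![n∸k]!∣n! k≤n))
      where open ℕₚ using (_!*_!≢0)

  factorial-binomial : ∀ {n m} → m ℕ.≤ n →
    factorial n ≈ ι (+ (n C m) / 1) * (factorial m * factorial (n ∸ m))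
  factorial-binomial {n} {m} m≤n = begin
    factorial n
      ≈⟨ reflexive (≡.cong (λ j → ι (+ j / 1)) (≡.sym (nCk*k!*[n∸k]! m≤n))) ⟩
    ι (+ ((n C m) ℕ.* (m ! ℕ.* (n ∸ m) !)) / 1)
      ≈⟨ trans (ι-/1-* (n C m) (m ! ℕ.* (n ∸ m) !)) (*-congˡ (ι-/1-* (m !) ((n ∸ m) !))) ⟩
    ι (+ (n C m) / 1) * (factorial m * factorial (n ∸ m)) ∎

  -- Each summand receives n! in the form C(n,m) m! (n - m)!. The index m follows the second factor
  -- because that is where the cosine or sine series stands, and the theorem lets m count its
  -- degree.
  egf-product : ∀ (f g : T.Carrier) n →
    factorial n * (f T.* g) n ≈
    ∑[ 0 to n ] (λ m → ι (+ (n C m) / 1) * (factorial m * g m) * (factorial (n ∸ m) * f (n ∸ m)))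
  egf-product f g n = begin
    factorial n * (f T.* g) n
      ≈⟨ *-congˡ (∑-reverse n (λ k → f k * g (n ∸ k))) ⟩
    factorial n * ∑[ 0 to n ] (λ m → f (n ∸ m) * g (n ∸ (n ∸ m)))
      ≈⟨ ∑-*ˡ (suc n) (factorial n) (λ m → f (n ∸ m) * g (n ∸ (n ∸ m))) ⟩
    ∑[ 0 to n ] (λ m → factorial n * (f (n ∸ m) * g (n ∸ (n ∸ m))))
      ≈⟨ ∑-cong (suc n) (λ m m<1+n → term m (ℕₚ.≤-pred m<1+n)) ⟩
    ∑[ 0 to n ] (λ m → ι (+ (n C m) / 1) * (factorial m * g m) * (factorial (n ∸ m) * f (n ∸ m))) ∎
    where
    term : ∀ m → m ℕ.≤ n → factorial n * (f (n ∸ m) * g (n ∸ (n ∸ m))) ≈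
      ι (+ (n C m) / 1) * (factorial m * g m) * (factorial (n ∸ m) * f (n ∸ m))
    term m m≤n = trans
      (*-cong (factorial-binomial m≤n) (*-congˡ (reflexive (≡.cong g (ℕₚ.m∸[m∸n]≡n m≤n)))))
      (solve 5 (λ b p q f g → b :* (p :* q) :* (f :* g) := b :* (p :* g) :* (q :* f)) refl
        (ι (+ (n C m) / 1)) (factorial m) (factorial (n ∸ m)) (f (n ∸ m)) (g m))

-- Complex numbers over a commutative ring, and conjugation

module Complexification {c ℓ} (R : CommutativeRing c ℓ) where

  open CommutativeRing R hiding (zero; _-_)
  open RingProperties ring using (-1*x≈-x; -‿distribˡ-*; -‿distribʳ-*; -‿+-comm; -0#≈0#; -‿involutive)
  open SetoidReasoning setoid
  open SemiringSolver commutativeSemiring using (solve; _:+_; _:*_; _:=_)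
  private
    module K = RawRing (complexify rawRing)

    -- Replacing the negations by a formal factor m (standing for -1) makes the
    -- ring laws into semiring identities: they hold in R[√m] for every m.
    neg : ∀ x → - x ≈ - 1# * x
    neg x = sym (-1*x≈-x x)

    *-assoc-re : ∀ a b c d e f →
      (a * c + - (b * d)) * e + - ((a * d + b * c) * f) ≈
      a * (c * e + - (d * f)) + - (b * (c * f + d * e))
    *-assoc-re a b c d e f = begin
      (a * c + - (b * d)) * e + - ((a * d + b * c) * f)
        ≈⟨ +-cong (*-congʳ (+-congˡ (neg _))) (neg _) ⟩
      (a * c + - 1# * (b * d)) * e + - 1# * ((a * d + b * c) * f)
        ≈⟨ solve 7 (λ m a b c d e f →
             (a :* c :+ m :* (b :* d)) :* e :+ m :* ((a :* d :+ b :* c) :* f) :=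
             a :* (c :* e :+ m :* (d :* f)) :+ m :* (b :* (c :* f :+ d :* e))) refl
             (- 1#) a b c d e f ⟩
      a * (c * e + - 1# * (d * f)) + - 1# * (b * (c * f + d * e))
        ≈⟨ sym (+-cong (*-congˡ (+-congˡ (neg _))) (neg _)) ⟩
      a * (c * e + - (d * f)) + - (b * (c * f + d * e)) ∎

    *-assoc-im : ∀ a b c d e f →
      (a * c + - (b * d)) * f + (a * d + b * c) * e ≈
      a * (c * f + d * e) + b * (c * e + - (d * f))
    *-assoc-im a b c d e f = begin
      (a * c + - (b * d)) * f + (a * d + b * c) * e
        ≈⟨ +-congʳ (*-congʳ (+-congˡ (neg _))) ⟩
      (a * c + - 1# * (b * d)) * f + (a * d + b * c) * e
        ≈⟨ solve 7 (λ m a b c d e f →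
             (a :* c :+ m :* (b :* d)) :* f :+ (a :* d :+ b :* c) :* e :=
             a :* (c :* f :+ d :* e) :+ b :* (c :* e :+ m :* (d :* f))) refl
             (- 1#) a b c d e f ⟩
      a * (c * f + d * e) + b * (c * e + - 1# * (d * f))
        ≈⟨ sym (+-congˡ (*-congˡ (+-congˡ (neg _)))) ⟩
      a * (c * f + d * e) + b * (c * e + - (d * f)) ∎

    distribˡ-re : ∀ a b c d e f →
      a * (c + e) + - (b * (d + f)) ≈ (a * c + - (b * d)) + (a * e + - (b * f))
    distribˡ-re a b c d e f = begin
      a * (c + e) + - (b * (d + f))
        ≈⟨ +-congˡ (neg _) ⟩
      a * (c + e) + - 1# * (b * (d + f))
        ≈⟨ solve 7 (λ m a b c d e f → a :* (c :+ e) :+ m :* (b :* (d :+ f)) :=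
             (a :* c :+ m :* (b :* d)) :+ (a :* e :+ m :* (b :* f))) refl (- 1#) a b c d e f ⟩
      (a * c + - 1# * (b * d)) + (a * e + - 1# * (b * f))
        ≈⟨ sym (+-cong (+-congˡ (neg _)) (+-congˡ (neg _))) ⟩
      (a * c + - (b * d)) + (a * e + - (b * f)) ∎

    distribˡ-im : ∀ a b c d e f →
      a * (d + f) + b * (c + e) ≈ (a * d + b * c) + (a * f + b * e)
    distribˡ-im = solve 6 (λ a b c d e f →
      a :* (d :+ f) :+ b :* (c :+ e) := (a :* d :+ b :* c) :+ (a :* f :+ b :* e)) refl

    x-0*y : ∀ x y → x + - (0# * y) ≈ x
    x-0*y x y = trans (+-congˡ (trans (-‿cong (zeroˡ y)) -0#≈0#)) (+-identityʳ x)

    x+0*y : ∀ x y → x + 0# * y ≈ x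
    x+0*y x y = trans (+-congˡ (zeroˡ y)) (+-identityʳ x)

    *-comm′ : ∀ x y → (x K.* y) K.≈ (y K.* x)
    *-comm′ (a , b) (c , d) = +-cong (*-comm a c) (-‿cong (*-comm b d))
                            , trans (+-comm _ _) (+-cong (*-comm b c) (*-comm a d))

    *-identityˡ′ : ∀ x → (K.1# K.* x) K.≈ x
    *-identityˡ′ (a , b) = trans (x-0*y _ _) (*-identityˡ a) , trans (x+0*y _ _) (*-identityˡ b)

    distribˡ′ : ∀ x y z → (x K.* (y K.+ z)) K.≈ ((x K.* y) K.+ (x K.* z))
    distribˡ′ (a , b) (c , d) (e , f) = distribˡ-re a b c d e f , distribˡ-im a b c d e f

    trans′ : ∀ {x y z} → x K.≈ y → y K.≈ z → x K.≈ z
    trans′ (p , q) (r , s) = trans p r , trans q s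

  commutativeRing : CommutativeRing c ℓ
  commutativeRing = record
    { RawRing (complexify rawRing)
    ; isCommutativeRing = record
      { isRing = record
        { +-isAbelianGroup = record
          { isGroup = record
            { isMonoid = record
              { isSemigroup = record
                { isMagma = record
                  { isEquivalence = record
                    { refl  = refl , refl
                    ; sym   = λ (p , q) → sym p , sym q
                    ; trans = trans′
                    }
                  ; ∙-cong = λ (p , q) (r , s) → +-cong p r , +-cong q s
                  }
                ; assoc = λ (a , b) (c , d) (e , f) → +-assoc a c e , +-assoc b d f
                }
              ; identity = (λ (a , b) → +-identityˡ a , +-identityˡ b)
                         , (λ (a , b) → +-identityʳ a , +-identityʳ b)
              }
            ; inverse = (λ (a , b) → -‿inverseˡ a , -‿inverseˡ b)
                      , (λ (a , b) → -‿inverseʳ a , -‿inverseʳ b)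
            ; ⁻¹-cong = λ (p , q) → -‿cong p , -‿cong q
            }
          ; comm = λ (a , b) (c , d) → +-comm a c , +-comm b d
          }
        ; *-cong = λ (p , q) (r , s) → +-cong (*-cong p r) (-‿cong (*-cong q s))
                                     , +-cong (*-cong p s) (*-cong q r)
        ; *-assoc = λ (a , b) (c , d) (e , f) → *-assoc-re a b c d e f , *-assoc-im a b c d e f
        ; *-identity = *-identityˡ′ , λ x → trans′ (*-comm′ x K.1#) (*-identityˡ′ x)
        ; distrib = distribˡ′ , λ x y z → trans′ (*-comm′ (y K.+ z) x) (trans′ (distribˡ′ x y z)
            (let p , q = *-comm′ x y ; r , s = *-comm′ x z in +-cong p r , +-cong q s))
        }
      ; *-comm = *-comm′
      }
    }

  real : Carrier → K.Carrier
  real x = x , 0#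

  real-isRingHomomorphism : IsRingHomomorphism rawRing (complexify rawRing) real
  real-isRingHomomorphism = Homomorphisms.isRingHomomorphism real
    (λ x≈y → x≈y , refl)
    (λ x y → refl , sym (+-identityˡ 0#))
    (λ x y → sym (x-0*y _ _) , sym (trans (x+0*y _ _) (zeroʳ x)))
    (λ x → refl , sym -0#≈0#)
    (refl , refl)
    (refl , refl)

  conj : K.Carrier → K.Carrier
  conj (a , b) = a , - b

  conj-isRingHomomorphism : IsRingHomomorphism (complexify rawRing) (complexify rawRing) conj
  conj-isRingHomomorphism = Homomorphisms.isRingHomomorphism conj
    (λ (p , q) → p , -‿cong q)
    (λ (a , b) (c , d) → refl , sym (-‿+-comm b d))
    (λ (a , b) (c , d) →
        +-congˡ (-‿cong (sym (trans (sym (-‿distribˡ-* b (- d)))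
          (trans (-‿cong (sym (-‿distribʳ-* b d))) (-‿involutive (b * d))))))
      , trans (sym (-‿+-comm _ _)) (+-cong (-‿distribʳ-* a d) (-‿distribˡ-* b c)))
    (λ (a , b) → refl , refl)
    (refl , -0#≈0#)
    (refl , -0#≈0#)

  i : K.Carrier
  i = 0# , 1#

  i*i : (i K.* i) K.≈ (K.- K.1#)
  i*i = trans (+-cong (zeroˡ 0#) (-‿cong (*-identityˡ 1#))) (+-identityˡ _)
      , trans (+-cong (zeroˡ 1#) (zeroʳ 1#)) (trans (+-identityˡ 0#) (sym -0#≈0#))

  conj-real : ∀ x → conj (real x) K.≈ real x
  conj-real x = refl , -0#≈0#

  conj-i : conj i K.≈ (K.- i)
  conj-i = sym -0#≈0# , refl

-- The commutative ring of Cauchy reals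

module RealNumbers where

  open RingOps ℝ-rawRing

  -- The ring laws already hold in ℚ at every index, so N = 0 serves for every ε. Estimates are left
  -- only for compatibility with `_≈_`.
  pointwise : ∀ {x y} → (∀ n → seq x n ≡ seq y n) → x ≈ y
  pointwise {x} {y} x≡y ε 0<ε = 0 , λ n _ → ≡.subst (λ q → ℚ.∣ q ∣ ℚ.≤ ε)
    (≡.sym (≡.trans (≡.cong (ℚ._- seq y n) (x≡y n)) (ℚₚ.+-inverseʳ (seq y n)))) (ℚₚ.<⇒≤ 0<ε)

  private
    m⊔n≤o⇒m≤o : ∀ {m n o} → m ℕ.⊔ n ℕ.≤ o → m ℕ.≤ o
    m⊔n≤o⇒m≤o {m} {n} = ℕₚ.m⊔n≤o⇒m≤o m n

    m⊔n≤o⇒n≤o : ∀ {m n o} → m ℕ.⊔ n ℕ.≤ o → n ℕ.≤ o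
    m⊔n≤o⇒n≤o {m} {n} = ℕₚ.m⊔n≤o⇒n≤o m n

    ∣-∣-sym : ∀ p q → ℚ.∣ p ℚ.- q ∣ ≡ ℚ.∣ q ℚ.- p ∣
    ∣-∣-sym p q = ≡.trans (≡.sym (ℚₚ.∣-p∣≡∣p∣ (p ℚ.- q)))
      (≡.cong ℚ.∣_∣ (solve 2 (λ p q → :- (p :- q) := q :- p) ≡.refl p q))
      where open +-*-Solver

    halves : ∀ {p q ε} → ℚ.∣ p ∣ ℚ.≤ ½ ℚ.* ε → ℚ.∣ q ∣ ℚ.≤ ½ ℚ.* ε → ℚ.∣ p ℚ.+ q ∣ ℚ.≤ ε
    halves {p} {q} {ε} p≤ q≤ = ≡.subst (ℚ.∣ p ℚ.+ q ∣ ℚ.≤_) (half+half ε)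
      (ℚₚ.≤-trans (ℚₚ.∣p+q∣≤∣p∣+∣q∣ p q) (ℚₚ.+-mono-≤ p≤ q≤))

  ≈-sym : ∀ {x y} → x ≈ y → y ≈ x
  ≈-sym {x} {y} x≈y ε 0<ε with x≈y ε 0<ε
  ... | N , p = N , λ n N≤n → ≡.subst (ℚ._≤ ε) (∣-∣-sym (seq x n) (seq y n)) (p n N≤n)

  ≈-trans : ∀ {x y z} → x ≈ y → y ≈ z → x ≈ z
  ≈-trans {x} {y} {z} x≈y y≈z ε 0<ε
    with x≈y (½ ℚ.* ε) (half-pos 0<ε) | y≈z (½ ℚ.* ε) (half-pos 0<ε)
  ... | N , p | M , q = N ℕ.⊔ M , λ n N⊔M≤n → ≡.subst (λ r → ℚ.∣ r ∣ ℚ.≤ ε)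
    (solve 3 (λ a b c → (a :- b) :+ (b :- c) := a :- c) ≡.refl (seq x n) (seq y n) (seq z n))
    (halves {seq x n ℚ.- seq y n} (p n (m⊔n≤o⇒m≤o N⊔M≤n)) (q n (m⊔n≤o⇒n≤o N⊔M≤n)))
    where open +-*-Solver

  +-cong : ∀ {x y u v} → x ≈ y → u ≈ v → x + u ≈ y + v
  +-cong {x} {y} {u} {v} x≈y u≈v ε 0<ε
    with x≈y (½ ℚ.* ε) (half-pos 0<ε) | u≈v (½ ℚ.* ε) (half-pos 0<ε)
  ... | N , p | M , q = N ℕ.⊔ M , λ n N⊔M≤n → ≡.subst (λ r → ℚ.∣ r ∣ ℚ.≤ ε)
    (solve 4 (λ a b c d → (a :- b) :+ (c :- d) := (a :+ c) :- (b :+ d)) ≡.refl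
      (seq x n) (seq y n) (seq u n) (seq v n))
    (halves {seq x n ℚ.- seq y n} (p n (m⊔n≤o⇒m≤o N⊔M≤n)) (q n (m⊔n≤o⇒n≤o N⊔M≤n)))
    where open +-*-Solver

  -‿cong : ∀ {x y} → x ≈ y → - x ≈ - y
  -‿cong {x} {y} x≈y ε 0<ε with x≈y ε 0<ε
  ... | N , p = N , λ n N≤n → ≡.subst (ℚ._≤ ε)
    (≡.trans (∣-∣-sym (seq x n) (seq y n)) (≡.cong ℚ.∣_∣
      (solve 2 (λ a b → b :- a := (:- a) :- (:- b)) ≡.refl (seq x n) (seq y n))))
    (p n N≤n)
    where open +-*-Solver

  -- Rests on x u - y v = x (u - v) + v (x - y). The tails of x and v are bounded by B and D, so u -
  -- v is brought within ε / (2B) and x - y within ε / (2D).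
  *-cong : ∀ {x y u v} → x ≈ y → u ≈ v → x * u ≈ y * v
  *-cong {x} {y} {u} {v} x≈y u≈v ε 0<ε =
    let B , 0<B , N₁ , x≤B = bounded (cauchy x)
        D , 0<D , N₂ , v≤D = bounded (cauchy v)
        δ , 0<δ , Bδ = shrink (half-pos 0<ε) 0<B
        η , 0<η , Dη = shrink (half-pos 0<ε) 0<D
        N₃ , p = u≈v δ 0<δ
        N₄ , q = x≈y η 0<η
        left  = λ {k} → m⊔n≤o⇒m≤o {N₁ ℕ.⊔ N₂} {N₃ ℕ.⊔ N₄} {k}
        right = λ {k} → m⊔n≤o⇒n≤o {N₁ ℕ.⊔ N₂} {N₃ ℕ.⊔ N₄} {k}
    in (N₁ ℕ.⊔ N₂) ℕ.⊔ (N₃ ℕ.⊔ N₄) , λ n ≤n →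
      product-close {seq x n} {seq u n} {seq y n} {seq v n} {ε = ε} 0<B 0<D
        (x≤B n (m⊔n≤o⇒m≤o {N₁} {N₂} (left ≤n)))
        (v≤D n (m⊔n≤o⇒n≤o {N₁} {N₂} (left ≤n)))
        (p n (m⊔n≤o⇒m≤o {N₃} {N₄} (right ≤n)))
        (q n (m⊔n≤o⇒n≤o {N₃} {N₄} (right ≤n)))
        Bδ Dη

  ℝ-commutativeRing : CommutativeRing 0ℓ 0ℓ
  ℝ-commutativeRing = record
    { RawRing ℝ-rawRing
    ; isCommutativeRing = record
      { isRing = record
        { +-isAbelianGroup = record
          { isGroup = record
            { isMonoid = record
              { isSemigroup = record
                { isMagma = record
                  { isEquivalence = record
                    { refl  = λ {x} → pointwise {x} {x} λ _ → ≡.refl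
                    ; sym   = λ {x} {y} → ≈-sym {x} {y}
                    ; trans = λ {x} {y} {z} → ≈-trans {x} {y} {z}
                    }
                  ; ∙-cong = λ {x} {y} {u} {v} → +-cong {x} {y} {u} {v}
                  }
                ; assoc = λ x y z → pointwise {x + y + z} {x + (y + z)}
                    λ n → ℚₚ.+-assoc (seq x n) (seq y n) (seq z n)
                }
              ; identity = (λ x → pointwise {0# + x} {x} λ n → ℚₚ.+-identityˡ (seq x n))
                         , (λ x → pointwise {x + 0#} {x} λ n → ℚₚ.+-identityʳ (seq x n))
              }
            ; inverse = (λ x → pointwise { - x + x} {0#} λ n → ℚₚ.+-inverseˡ (seq x n))
                      , (λ x → pointwise {x - x} {0#} λ n → ℚₚ.+-inverseʳ (seq x n))
            ; ⁻¹-cong = λ {x} {y} → -‿cong {x} {y}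
            }
          ; comm = λ x y → pointwise {x + y} {y + x} λ n → ℚₚ.+-comm (seq x n) (seq y n)
          }
        ; *-cong = λ {x} {y} {u} {v} → *-cong {x} {y} {u} {v}
        ; *-assoc = λ x y z → pointwise {x * y * z} {x * (y * z)}
            λ n → ℚₚ.*-assoc (seq x n) (seq y n) (seq z n)
        ; *-identity = (λ x → pointwise {1# * x} {x} λ n → ℚₚ.*-identityˡ (seq x n))
                     , (λ x → pointwise {x * 1#} {x} λ n → ℚₚ.*-identityʳ (seq x n))
        ; distrib = (λ x y z → pointwise {x * (y + z)} {x * y + x * z}
                      λ n → ℚₚ.*-distribˡ-+ (seq x n) (seq y n) (seq z n))
                  , (λ x y z → pointwise {(y + z) * x} {y * x + z * x}
                      λ n → ℚₚ.*-distribʳ-+ (seq x n) (seq y n) (seq z n))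
        }
      ; *-comm = λ x y → pointwise {x * y} {y * x} λ n → ℚₚ.*-comm (seq x n) (seq y n)
      }
    }

  fromℚ-isRingHomomorphism : IsRingHomomorphism ℚ.+-*-rawRing ℝ-rawRing fromℚ
  fromℚ-isRingHomomorphism = Homomorphisms.isRingHomomorphism fromℚ
    (λ {p} {q} p≡q → pointwise {fromℚ p} {fromℚ q} λ _ → p≡q)
    (λ p q → pointwise {fromℚ (p ℚ.+ q)} {fromℚ p + fromℚ q} λ _ → ≡.refl)
    (λ p q → pointwise {fromℚ (p ℚ.* q)} {fromℚ p * fromℚ q} λ _ → ≡.refl)
    (λ p → pointwise {fromℚ (ℚ.- p)} { - fromℚ p} λ _ → ≡.refl)
    (pointwise {fromℚ 0ℚ} {0#} λ _ → ≡.refl)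
    (pointwise {fromℚ 1ℚ} {1#} λ _ → ≡.refl)

-- Degenerate cosine and sine: coefficients and summation formulas

-- Abstract, so that instances at equal but differently presented rings are
-- compared argument by argument instead of being unfolded.
module TrigonometricCoefficients {c ℓ} (A : RawRing c ℓ) (ι : ℚ → RawRing.Carrier A) where

  open RawRing A using (Carrier; _*_)
  open Series A using (_∙_; module Exp)
  open Exp ι using (power1+)
  private module T = RingOps (powerSeries A)

  abstract

    -- In the application `h` is 1/2 or 1/(2i), and `u`, `v`, `w` are the exponents x / lam, iy /
    -- lam and -iy / lam.
    sumCoefficient differenceCoefficient : (lam h u v w : Carrier) → ℕ → Carrier
    sumCoefficient lam h u v w n = ι (+ (n !) / 1) *
      (power1+ lam u T.* (h ∙ (power1+ lam v T.+ power1+ lam w))) n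
    differenceCoefficient lam h u v w n = ι (+ (n !) / 1) *
      (power1+ lam u T.* (h ∙ (power1+ lam v T.- power1+ lam w))) n

    sumCoefficient-unfold : ∀ lam h u v w n → ι (+ (n !) / 1) *
      (power1+ lam u T.* (h ∙ (power1+ lam v T.+ power1+ lam w))) n ≡
      sumCoefficient lam h u v w n
    sumCoefficient-unfold lam h u v w n = ≡.refl

    differenceCoefficient-unfold : ∀ lam h u v w n → ι (+ (n !) / 1) *
      (power1+ lam u T.* (h ∙ (power1+ lam v T.- power1+ lam w))) n ≡
      differenceCoefficient lam h u v w n
    differenceCoefficient-unfold lam h u v w n = ≡.refl

-- K plays the role of the complexification R[i]; working with an abstract K
-- keeps complex numbers from being unfolded into pairs of reals.
module DegenerateTrigonometry {c ℓ c′ ℓ′} (R : CommutativeRing c ℓ) (K : CommutativeRing c′ ℓ′)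
  {ι : ℚ → CommutativeRing.Carrier R}
  (ι-hom : IsRingHomomorphism ℚ.+-*-rawRing (CommutativeRing.rawRing R) ι)
  {real : CommutativeRing.Carrier R → CommutativeRing.Carrier K}
  (real-hom : IsRingHomomorphism (CommutativeRing.rawRing R) (CommutativeRing.rawRing K) real)
  {conj : CommutativeRing.Carrier K → CommutativeRing.Carrier K}
  (conj-hom : IsRingHomomorphism (CommutativeRing.rawRing K) (CommutativeRing.rawRing K) conj)
  (conj-real : ∀ x → CommutativeRing._≈_ K (conj (real x)) (real x))
  (i : CommutativeRing.Carrier K)
  (conj-i : CommutativeRing._≈_ K (conj i) (CommutativeRing.-_ K i))
  (i*i : CommutativeRing._≈_ K (CommutativeRing._*_ K i i)
                               (CommutativeRing.-_ K (CommutativeRing.1# K))) where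

  open CommutativeRing R hiding (zero; _-_)
  open RingOps rawRing using (_^_; ∑[_to_]; fallingFactorial)
  open FiniteSums R
  open SemiringSolver commutativeSemiring using (solve; _:+_; _:*_; _:=_)
  private
    module ι = IsRingHomomorphism ι-hom
    module K where
      open CommutativeRing K public hiding (zero; _-_)
      open RingProperties (CommutativeRing.ring K) public
        using (-‿distribˡ-*; -‿distribʳ-*; -‿involutive; -‿+-comm)
      open SemiringSolver (CommutativeRing.commutativeSemiring K) public
        using (solve; _:+_; _:*_; _:=_)
      open RingOps (CommutativeRing.rawRing K) public using (_^_; fallingFactorial)
    module KSums = FiniteSums K
    module T = RingOps (powerSeries K.rawRing)
    module real = IsRingHomomorphism real-hom
    module Real = Preservation K real-hom
    module conj = IsRingHomomorphism conj-hom

  φ : ℤ → Carrier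
  φ z = ι (z / 1)

  φ-isRingHomomorphism : IsRingHomomorphism ℤ.+-*-rawRing rawRing φ
  φ-isRingHomomorphism =
    Composition.isRingHomomorphism trans Fractions./1-isRingHomomorphism ι-hom

  open StirlingExpansion R φ-isRingHomomorphism using (φ-S¹-high)
  private
    ιᴷ-hom = Composition.isRingHomomorphism K.trans ι-hom real-hom
    φᴷ-hom = Composition.isRingHomomorphism K.trans φ-isRingHomomorphism real-hom
    module S = StirlingExpansion K φᴷ-hom

  open BinomialSeries K ιᴷ-hom using (factorial; factorial*power1+)
  open ExponentialProduct K ιᴷ-hom using (egf-product)
  open Series.Exp K.rawRing (λ q → real (ι q)) using (power1+)
  open Series K.rawRing using (_∙_)
  open TrigonometricCoefficients K.rawRing (λ q → real (ι q))

  module _ (lam μ : Carrier) (μ*lam≈1 : μ * lam ≈ 1#) where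

    degenerateExp : K.Carrier → T.Carrier
    degenerateExp z = power1+ (real lam) (z K.* real μ)

    -- The inverse `μ` of `lam` disappears here, since (z μ) lam = z; the resulting coefficients are
    -- polynomial in lam and z.
    factorial*degenerateExp : ∀ z n →
      factorial n K.* degenerateExp z n K.≈ K.fallingFactorial (real lam) z n
    factorial*degenerateExp z = factorial*power1+ (real lam) (z K.* real μ) (begin
      (z K.* real μ) K.* real lam  ≈⟨ K.*-assoc z (real μ) (real lam) ⟩
      z K.* (real μ K.* real lam)  ≈⟨ K.*-congˡ (K.sym (real.*-homo μ lam)) ⟩
      z K.* real (μ * lam)         ≈⟨ K.*-congˡ (K.trans (real.⟦⟧-cong μ*lam≈1) real.1#-homo) ⟩
      z K.* K.1#                   ≈⟨ K.*-identityʳ z ⟩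
      z                            ∎)
      where open SetoidReasoning K.setoid

    private
      -- Beyond the upper limit of k the index 2k exceeds m, where the Stirling numbers vanish. This
      -- is what permits the sums over k to be lengthened and shortened.
      half<⇒<double : ∀ m k → ⌊ m /2⌋ ℕ.< k → m ℕ.< 2 ℕ.* k
      half<⇒<double zero          (suc k) _ = z<s
      half<⇒<double (suc zero)    (suc k) _ =
        ≡.subst (1 ℕ.<_) (≡.sym (ℕₚ.*-suc 2 k)) (s<s z<s)
      half<⇒<double (suc (suc m)) (suc k) (s≤s p) =
        ≡.subst (suc (suc m) ℕ.<_) (≡.sym (ℕₚ.*-suc 2 k)) (s<s (s<s (half<⇒<double m k p)))

      half<⇒<double+1 : ∀ m k → ⌊ m ∸ 1 /2⌋ ℕ.< k → m ℕ.< 2 ℕ.* k ℕ.+ 1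
      half<⇒<double+1 m k p = ≡.subst (m ℕ.<_) (ℕₚ.+-comm 1 (2 ℕ.* k)) (go m p)
        where
        go : ∀ m → ⌊ m ∸ 1 /2⌋ ℕ.< k → m ℕ.< suc (2 ℕ.* k)
        go zero    _ = z<s
        go (suc m) p = s<s (half<⇒<double m k p)

    module _ (y : Carrier) where

      cosTerm sinTerm : ℕ → ℕ → Carrier
      cosTerm m k = lam ^ (m ∸ 2 ℕ.* k) * (- 1#) ^ k * y ^ (2 ℕ.* k) * φ (S¹ m (2 ℕ.* k))
      sinTerm m k =
        lam ^ (m ∸ 2 ℕ.* k ∸ 1) * (- 1#) ^ k * y ^ (2 ℕ.* k ℕ.+ 1) * φ (S¹ m (2 ℕ.* k ℕ.+ 1))

      -- These are the P and Q in (iy)_{m,lam} = P + iQ. For m = 0 the truncated bound of the second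
      -- sum still admits k = 0, with the value zero because `S¹ 0 1` is zero.
      cosCoefficient sinCoefficient : ℕ → Carrier
      cosCoefficient m = ∑[ 0 to ⌊ m /2⌋ ] (cosTerm m)
      sinCoefficient m = ∑[ 0 to ⌊ m ∸ 1 /2⌋ ] (sinTerm m)

      private
        z : K.Carrier
        z = i K.* real y

        z*z : (z K.* z) K.≈ real (- 1# * (y * y))
        z*z = begin
          (i K.* real y) K.* (i K.* real y)
            ≈⟨ K.solve 2 (λ i y → (i K.:* y) K.:* (i K.:* y) K.:= (i K.:* i) K.:* (y K.:* y))
                 K.refl i (real y) ⟩
          (i K.* i) K.* (real y K.* real y)
            ≈⟨ K.*-cong (K.trans i*i (K.trans (K.-‿cong (K.sym real.1#-homo))
                 (K.sym (real.-‿homo 1#)))) (K.sym (real.*-homo y y)) ⟩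
          real (- 1#) K.* real (y * y)
            ≈⟨ K.sym (real.*-homo (- 1#) (y * y)) ⟩
          real (- 1# * (y * y)) ∎
          where open SetoidReasoning K.setoid

        -- Even powers of iy are real because its square is -y². The exponent `k * 2` lets two
        -- factors split off by computation.
        z^even : ∀ k → (z K.^ (k ℕ.* 2)) K.≈ real ((- 1#) ^ k * y ^ (k ℕ.* 2))
        z^even zero    = K.sym (K.trans (real.⟦⟧-cong (*-identityˡ 1#)) real.1#-homo)
        z^even (suc k) = begin
          z K.* (z K.* z K.^ (k ℕ.* 2))
            ≈⟨ K.sym (K.*-assoc z z _) ⟩
          (z K.* z) K.* z K.^ (k ℕ.* 2)
            ≈⟨ K.*-cong z*z (z^even k) ⟩
          real (- 1# * (y * y)) K.* real ((- 1#) ^ k * y ^ (k ℕ.* 2))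
            ≈⟨ K.sym (real.*-homo _ _) ⟩
          real (- 1# * (y * y) * ((- 1#) ^ k * y ^ (k ℕ.* 2)))
            ≈⟨ real.⟦⟧-cong (solve 4 (λ m y s p → m :* (y :* y) :* (s :* p) :=
                 m :* s :* (y :* (y :* p))) refl (- 1#) y ((- 1#) ^ k) (y ^ (k ℕ.* 2))) ⟩
          real ((- 1#) ^ suc k * y ^ (suc k ℕ.* 2)) ∎
          where open SetoidReasoning K.setoid

        t : ℕ → ℕ → K.Carrier
        t = S.stirlingTerm (real lam) z

        -- Gathers the three occurrences of the power j, so that a single equation such as
        -- `k * 2 = 2 * k` rewrites all of them at once.
        monomial : ℕ → ℕ → ℕ → Carrier
        monomial m k j = φ (S¹ m j) * lam ^ (m ∸ j) * ((- 1#) ^ k * y ^ j)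

        t-even : ∀ m k → t m (k ℕ.* 2) K.≈ real (cosTerm m k)
        t-even m k = begin
          real (φ (S¹ m (k ℕ.* 2))) K.* real lam K.^ (m ∸ k ℕ.* 2) K.* z K.^ (k ℕ.* 2)
            ≈⟨ K.*-cong (K.*-congˡ (K.sym (Real.^-homo lam (m ∸ k ℕ.* 2)))) (z^even k) ⟩
          real (φ (S¹ m (k ℕ.* 2))) K.* real (lam ^ (m ∸ k ℕ.* 2)) K.*
            real ((- 1#) ^ k * y ^ (k ℕ.* 2))
            ≈⟨ K.sym (K.trans (real.*-homo _ _) (K.*-congʳ (real.*-homo _ _))) ⟩
          real (monomial m k (k ℕ.* 2))
            ≈⟨ real.⟦⟧-cong (reflexive (≡.cong (monomial m k) (ℕₚ.*-comm k 2))) ⟩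
          real (monomial m k (2 ℕ.* k))
            ≈⟨ real.⟦⟧-cong (solve 4 (λ f l s p → f :* l :* (s :* p) := l :* s :* p :* f) refl
                 (φ (S¹ m (2 ℕ.* k))) (lam ^ (m ∸ 2 ℕ.* k)) ((- 1#) ^ k) (y ^ (2 ℕ.* k))) ⟩
          real (cosTerm m k) ∎
          where open SetoidReasoning K.setoid

        t-odd : ∀ m k → t m (suc (k ℕ.* 2)) K.≈ (i K.* real (sinTerm m k))
        t-odd m k = begin
          real f K.* real lam K.^ e K.* ((i K.* real y) K.* z K.^ (k ℕ.* 2))
            ≈⟨ K.*-cong (K.*-congˡ (K.sym (Real.^-homo lam e))) (K.*-congˡ (z^even k)) ⟩
          real f K.* real (lam ^ e) K.* ((i K.* real y) K.* real w)
            ≈⟨ K.solve 5 (λ f l i y w → f K.:* l K.:* ((i K.:* y) K.:* w) K.:=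
                 i K.:* (f K.:* l K.:* (y K.:* w))) K.refl
                 (real f) (real (lam ^ e)) i (real y) (real w) ⟩
          i K.* (real f K.* real (lam ^ e) K.* (real y K.* real w))
            ≈⟨ K.*-congˡ (K.sym (K.trans (real.*-homo _ _)
                 (K.*-cong (real.*-homo _ _) (real.*-homo _ _)))) ⟩
          i K.* real (f * lam ^ e * (y * w))
            ≈⟨ K.*-congˡ (real.⟦⟧-cong (solve 5 (λ f l y s p →
                 f :* l :* (y :* (s :* p)) := f :* l :* (s :* (y :* p))) refl
                 f (lam ^ e) y ((- 1#) ^ k) (y ^ (k ℕ.* 2)))) ⟩
          i K.* real (monomial m k (suc (k ℕ.* 2)))
            ≈⟨ K.*-congˡ (real.⟦⟧-cong (reflexive (≡.cong (monomial m k)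
                 (≡.trans (≡.cong suc (ℕₚ.*-comm k 2)) (ℕₚ.+-comm 1 (2 ℕ.* k)))))) ⟩
          i K.* real (monomial m k (2 ℕ.* k ℕ.+ 1))
            ≈⟨ K.*-congˡ (real.⟦⟧-cong (*-congʳ (*-congˡ (reflexive
                 (≡.cong (lam ^_) (≡.sym (ℕₚ.∸-+-assoc m (2 ℕ.* k) 1))))))) ⟩
          i K.* real (φ (S¹ m (2 ℕ.* k ℕ.+ 1)) * lam ^ (m ∸ 2 ℕ.* k ∸ 1) *
            ((- 1#) ^ k * y ^ (2 ℕ.* k ℕ.+ 1)))
            ≈⟨ K.*-congˡ (real.⟦⟧-cong
                 (solve 4 (λ f l s p → f :* l :* (s :* p) := l :* s :* p :* f) refl
                 (φ (S¹ m (2 ℕ.* k ℕ.+ 1))) (lam ^ (m ∸ 2 ℕ.* k ∸ 1)) ((- 1#) ^ k)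
                 (y ^ (2 ℕ.* k ℕ.+ 1)))) ⟩
          i K.* real (sinTerm m k) ∎
          where
          open SetoidReasoning K.setoid
          f = φ (S¹ m (suc (k ℕ.* 2)))
          e = m ∸ suc (k ℕ.* 2)
          w = (- 1#) ^ k * y ^ (k ℕ.* 2)

      cosTerm-high : ∀ m k → m ℕ.< 2 ℕ.* k → cosTerm m k ≈ 0#
      cosTerm-high m k m<2k = trans (*-congˡ (φ-S¹-high m (2 ℕ.* k) m<2k)) (zeroʳ _)

      sinTerm-high : ∀ m k → m ℕ.< 2 ℕ.* k ℕ.+ 1 → sinTerm m k ≈ 0#
      sinTerm-high m k m<2k+1 = trans (*-congˡ (φ-S¹-high m (2 ℕ.* k ℕ.+ 1) m<2k+1)) (zeroʳ _)

      fallingFactorial-iy : ∀ m →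
        K.fallingFactorial (real lam) (i K.* real y) m K.≈
        (real (cosCoefficient m) K.+ i K.* real (sinCoefficient m))
      fallingFactorial-iy m = begin
        K.fallingFactorial (real lam) z m
          ≈⟨ S.fallingFactorial-expansion (real lam) z m ⟩
        KSums.∑< (suc m) (t m)
          -- The sum is padded with zero terms l > m to the even length 2(m + 1), as the parity
          -- splitting needs; the two halves are cut back to their proper bounds at the end.
          ≈⟨ K.sym (KSums.∑-truncate (ℕₚ.m≤m*n (suc m) 2)
               λ l m<l → S.stirlingTerm-high (real lam) z m l m<l) ⟩
        KSums.∑< (suc m ℕ.* 2) (t m)
          ≈⟨ KSums.∑-parity (suc m) (t m) ⟩
        KSums.∑< (suc m) (λ k → t m (k ℕ.* 2)) K.+ KSums.∑< (suc m) (λ k → t m (suc (k ℕ.* 2)))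
          ≈⟨ K.+-cong (KSums.∑-cong (suc m) λ k _ → t-even m k)
                      (KSums.∑-cong (suc m) λ k _ → t-odd m k) ⟩
        KSums.∑< (suc m) (λ k → real (cosTerm m k)) K.+
        KSums.∑< (suc m) (λ k → i K.* real (sinTerm m k))
          ≈⟨ K.+-cong (K.sym (Real.∑-homo m (cosTerm m))) (K.trans
               (K.sym (KSums.∑-*ˡ (suc m) i (λ k → real (sinTerm m k))))
               (K.*-congˡ (K.sym (Real.∑-homo m (sinTerm m))))) ⟩
        real (∑[ 0 to m ] (cosTerm m)) K.+ i K.* real (∑[ 0 to m ] (sinTerm m))
          ≈⟨ K.+-cong
               (real.⟦⟧-cong (∑-truncate (ℕ.s≤s (ℕₚ.⌊n/2⌋≤n m)) λ k h<k →
                  cosTerm-high m k (half<⇒<double m k h<k)))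
               (K.*-congˡ (real.⟦⟧-cong (∑-truncate
                  (ℕ.s≤s (ℕₚ.≤-trans (ℕₚ.⌊n/2⌋≤n (m ∸ 1)) (ℕₚ.m∸n≤m m 1))) λ k h<k →
                  sinTerm-high m k (half<⇒<double+1 m k h<k)))) ⟩
        real (cosCoefficient m) K.+ i K.* real (sinCoefficient m) ∎
        where open SetoidReasoning K.setoid

      -- Spares a second parity argument: a falling factorial is built from ring operations, with
      -- which conjugation commutes.
      fallingFactorial-[-iy] : ∀ m →
        K.fallingFactorial (real lam) (K.- (i K.* real y)) m K.≈
        (real (cosCoefficient m) K.+ K.- (i K.* real (sinCoefficient m)))
      fallingFactorial-[-iy] m = begin
        K.fallingFactorial (real lam) (K.- z) m
          ≈⟨ FallingFactorials.fallingFactorial-cong K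
               (K.sym (conj-real lam)) (K.sym (conj-i*real y)) m ⟩
        K.fallingFactorial (conj (real lam)) (conj z) m
          ≈⟨ K.sym (Preservation.fallingFactorial-homo K conj-hom (real lam) z m) ⟩
        conj (K.fallingFactorial (real lam) z m)
          ≈⟨ conj.⟦⟧-cong (fallingFactorial-iy m) ⟩
        conj (real (cosCoefficient m) K.+ i K.* real (sinCoefficient m))
          ≈⟨ K.trans (conj.+-homo _ _) (K.+-cong (conj-real _) (conj-i*real _)) ⟩
        real (cosCoefficient m) K.+ K.- (i K.* real (sinCoefficient m)) ∎
        where
        open SetoidReasoning K.setoid
        conj-i*real : ∀ x → conj (i K.* real x) K.≈ (K.- (i K.* real x))
        conj-i*real x = K.trans (conj.*-homo i (real x))
          (K.trans (K.*-cong conj-i (conj-real x)) (K.sym (K.-‿distribˡ-* i (real x))))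

      degenerateCos degenerateSin : T.Carrier
      degenerateCos = real (ι ½) ∙ (degenerateExp z T.+ degenerateExp (K.- z))
      degenerateSin = (real (ι ½) K.* (K.- i)) ∙ (degenerateExp z T.- degenerateExp (K.- z))

      private
        ½+½ : ∀ x → ι ½ * (x + x) ≈ x
        ½+½ x = begin
          ι ½ * (x + x)          ≈⟨ solve 2 (λ h x → h :* (x :+ x) := (h :+ h) :* x) refl _ _ ⟩
          (ι ½ + ι ½) * x      ≈⟨ *-congʳ (trans (sym (ι.+-homo ½ ½)) ι.1#-homo) ⟩
          1# * x                   ≈⟨ *-identityˡ x ⟩
          x                        ∎
          where open SetoidReasoning setoid

      factorial*degenerateCos : ∀ m → (factorial m K.* degenerateCos m) K.≈ real (cosCoefficient m)
      factorial*degenerateCos m = begin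
        factorial m K.* (real (ι ½) K.* (degenerateExp z m K.+ degenerateExp (K.- z) m))
          ≈⟨ K.solve 4 (λ n h a b → n K.:* (h K.:* (a K.:+ b)) K.:=
               h K.:* (n K.:* a K.:+ n K.:* b)) K.refl
               (factorial m) (real (ι ½)) (degenerateExp z m) (degenerateExp (K.- z) m) ⟩
        real (ι ½) K.*
          (factorial m K.* degenerateExp z m K.+ factorial m K.* degenerateExp (K.- z) m)
          ≈⟨ K.*-congˡ (K.+-cong
               (K.trans (factorial*degenerateExp z m) (fallingFactorial-iy m))
               (K.trans (factorial*degenerateExp (K.- z) m) (fallingFactorial-[-iy] m))) ⟩
        real (ι ½) K.* ((real P K.+ i K.* real Q) K.+ (real P K.+ K.- (i K.* real Q)))
          ≈⟨ K.*-congˡ (K.trans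
               (K.solve 3 (λ p q r → (p K.:+ q) K.:+ (p K.:+ r) K.:= (p K.:+ p) K.:+ (q K.:+ r))
                  K.refl (real P) (i K.* real Q) (K.- (i K.* real Q)))
               (K.trans (K.+-congˡ (K.-‿inverseʳ _)) (K.+-identityʳ _))) ⟩
        real (ι ½) K.* (real P K.+ real P)
          ≈⟨ K.sym (K.trans (real.*-homo (ι ½) (P + P)) (K.*-congˡ (real.+-homo P P))) ⟩
        real (ι ½ * (P + P))
          ≈⟨ real.⟦⟧-cong (½+½ P) ⟩
        real P ∎
        where
        open SetoidReasoning K.setoid
        P = cosCoefficient m
        Q = sinCoefficient m

      factorial*degenerateSin : ∀ m → (factorial m K.* degenerateSin m) K.≈ real (sinCoefficient m)
      factorial*degenerateSin m = begin
        factorial m K.* (h K.* (a K.+ K.- b))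
          ≈⟨ K.solve 4 (λ n h a b → n K.:* (h K.:* (a K.:+ b)) K.:=
               h K.:* (n K.:* a K.:+ n K.:* b)) K.refl (factorial m) h a (K.- b) ⟩
        h K.* (factorial m K.* a K.+ factorial m K.* (K.- b))
          ≈⟨ K.*-congˡ (K.+-congˡ (K.sym (K.-‿distribʳ-* (factorial m) b))) ⟩
        h K.* (factorial m K.* a K.+ K.- (factorial m K.* b))
          ≈⟨ K.*-congˡ (K.+-cong
               (K.trans (factorial*degenerateExp z m) (fallingFactorial-iy m))
               (K.-‿cong (K.trans (factorial*degenerateExp (K.- z) m) (fallingFactorial-[-iy] m)))) ⟩
        h K.* ((real P K.+ i K.* real Q) K.+ K.- (real P K.+ K.- (i K.* real Q)))
          ≈⟨ K.*-congˡ (difference (real P) (i K.* real Q)) ⟩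
        h K.* (i K.* real Q K.+ i K.* real Q)
          ≈⟨ K.*-congˡ (K.sym (K.trans (K.*-congˡ (real.+-homo Q Q)) (K.distribˡ i _ _))) ⟩
        (real (ι ½) K.* (K.- i)) K.* (i K.* real (Q + Q))
          -- Brings the -i coming from 1/(2i) next to the i of the imaginary part; their product is
          -- 1.
          ≈⟨ K.solve 4 (λ h j i q → (h K.:* j) K.:* (i K.:* q) K.:= (j K.:* i) K.:* (h K.:* q))
               K.refl (real (ι ½)) (K.- i) i (real (Q + Q)) ⟩
        ((K.- i) K.* i) K.* (real (ι ½) K.* real (Q + Q))
          ≈⟨ K.*-cong -i*i (K.trans (K.sym (real.*-homo _ _)) (real.⟦⟧-cong (½+½ Q))) ⟩
        K.1# K.* real Q
          ≈⟨ K.*-identityˡ (real Q) ⟩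
        real Q ∎
        where
        open SetoidReasoning K.setoid
        P = cosCoefficient m
        Q = sinCoefficient m
        h = real (ι ½) K.* (K.- i)
        a = degenerateExp z m
        b = degenerateExp (K.- z) m
        -i*i : ((K.- i) K.* i) K.≈ K.1#
        -i*i = K.trans (K.sym (K.-‿distribˡ-* i i)) (K.trans (K.-‿cong i*i) (K.-‿involutive K.1#))
        difference : ∀ p q → ((p K.+ q) K.+ K.- (p K.+ K.- q)) K.≈ (q K.+ q)
        difference p q = begin
          (p K.+ q) K.+ K.- (p K.+ K.- q)
            ≈⟨ K.+-congˡ (K.trans (K.sym (K.-‿+-comm p (K.- q))) (K.+-congˡ (K.-‿involutive q))) ⟩
          (p K.+ q) K.+ (K.- p K.+ q)
            ≈⟨ K.solve 3 (λ p q r → (p K.:+ q) K.:+ (r K.:+ q) K.:= (p K.:+ r) K.:+ (q K.:+ q))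
                 K.refl p q (K.- p) ⟩
          (p K.+ K.- p) K.+ (q K.+ q)
            ≈⟨ K.trans (K.+-congʳ (K.-‿inverseʳ p)) (K.+-identityˡ _) ⟩
          q K.+ q ∎

    module _ (x : Carrier) where

      -- Shared by cosine and sine: `g` is any series whose exponential coefficients are real. Those
      -- of the first factor are the real numbers (x)_{n-m,lam}, so the whole convolution lies in
      -- the image of `real`.
      product-coefficient : ∀ (g : T.Carrier) (p : ℕ → Carrier) →
        (∀ m → (factorial m K.* g m) K.≈ real (p m)) → ∀ n →
        (factorial n K.* (degenerateExp (real x) T.* g) n) K.≈
        real (∑[ 0 to n ] (λ m → φ (+ (n C m)) * p m * fallingFactorial lam x (n ∸ m)))
      product-coefficient g p g≈p n = begin
        factorial n K.* (degenerateExp (real x) T.* g) n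
          ≈⟨ egf-product (degenerateExp (real x)) g n ⟩
        KSums.∑< (suc n) (λ m → real (φ (+ (n C m))) K.* (factorial m K.* g m) K.*
          (factorial (n ∸ m) K.* degenerateExp (real x) (n ∸ m)))
          ≈⟨ KSums.∑-cong (suc n) (λ m _ → K.trans
               (K.*-cong (K.*-congˡ (g≈p m)) (K.trans (factorial*degenerateExp (real x) (n ∸ m))
                 (K.sym (Real.fallingFactorial-homo lam x (n ∸ m)))))
               (K.sym (K.trans (real.*-homo _ _) (K.*-congʳ (real.*-homo (φ (+ (n C m))) (p m)))))) ⟩
        KSums.∑< (suc n) (λ m → real (φ (+ (n C m)) * p m * fallingFactorial lam x (n ∸ m)))
          ≈⟨ K.sym (Real.∑-homo n (λ m →
               φ (+ (n C m)) * p m * fallingFactorial lam x (n ∸ m))) ⟩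
        real (∑[ 0 to n ] (λ m → φ (+ (n C m)) * p m * fallingFactorial lam x (n ∸ m))) ∎
        where open SetoidReasoning K.setoid

      private
        distribute : ∀ n m b (l s y f : ℕ → Carrier) →
          φ (+ (n C m)) * ∑[ 0 to b ] (λ k → l k * s k * y k * f k) *
            fallingFactorial lam x (n ∸ m) ≈
          ∑[ 0 to b ] (λ k → φ (+ (n C m)) * l k * s k * y k * f k * fallingFactorial lam x (n ∸ m))
        distribute n m b l s y f = trans (*-congʳ (∑-*ˡ (suc b) nCm u))
          (trans (∑-*ʳ (suc b) e (λ k → nCm * u k))
            (∑-cong (suc b) λ k _ → solve 6 (λ c l s y f e →
              c :* (l :* s :* y :* f) :* e := c :* l :* s :* y :* f :* e) refl
              nCm (l k) (s k) (y k) (f k) e))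
          where
          nCm = φ (+ (n C m))
          e = fallingFactorial lam x (n ∸ m)
          u = λ k → l k * s k * y k * f k

      module _ (y : Carrier) where

        cosSummand sinSummand : ℕ → ℕ → ℕ → Carrier
        cosSummand n m k =
          φ (+ (n C m)) * lam ^ (m ∸ 2 ℕ.* k) * (- 1#) ^ k * y ^ (2 ℕ.* k)
            * φ (S¹ m (2 ℕ.* k)) * fallingFactorial lam x (n ∸ m)
        sinSummand n m k =
          φ (+ (n C m)) * lam ^ (m ∸ 2 ℕ.* k ∸ 1) * (- 1#) ^ k * y ^ (2 ℕ.* k ℕ.+ 1)
            * φ (S¹ m (2 ℕ.* k ℕ.+ 1)) * fallingFactorial lam x (n ∸ m)

        cosSummand-high : ∀ n m k → m ℕ.< 2 ℕ.* k → cosSummand n m k ≈ 0#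
        cosSummand-high n m k m<2k =
          trans (*-congʳ (trans (*-congˡ (φ-S¹-high m (2 ℕ.* k) m<2k)) (zeroʳ _))) (zeroˡ _)

        sinSummand-high : ∀ n m k → m ℕ.< 2 ℕ.* k ℕ.+ 1 → sinSummand n m k ≈ 0#
        sinSummand-high n m k m<2k+1 =
          trans (*-congʳ (trans (*-congˡ (φ-S¹-high m (2 ℕ.* k ℕ.+ 1) m<2k+1)) (zeroʳ _))) (zeroˡ _)

        cos-formula : ∀ {s} n →
          s ≡ sumCoefficient (real lam) (real (ι ½)) (real x K.* real μ)
                ((i K.* real y) K.* real μ) ((K.- (i K.* real y)) K.* real μ) n →
          s K.≈ real (∑[ 0 to n ] λ m → ∑[ 0 to ⌊ m /2⌋ ] (cosSummand n m))
        cos-formula n s≡ = K.trans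
          (K.reflexive (≡.trans s≡ (≡.sym (sumCoefficient-unfold _ _ _ _ _ n)))) (K.trans
          (product-coefficient (degenerateCos y) (cosCoefficient y) (factorial*degenerateCos y) n)
          (real.⟦⟧-cong (∑-cong (suc n) λ m _ → distribute n m ⌊ m /2⌋
            (λ k → lam ^ (m ∸ 2 ℕ.* k)) ((- 1#) ^_) (λ k → y ^ (2 ℕ.* k))
            (λ k → φ (S¹ m (2 ℕ.* k))))))

        cos-swap : ∀ n →
          ∑[ 0 to n ] (λ m → ∑[ 0 to ⌊ m /2⌋ ] (cosSummand n m)) ≈
          ∑[ 0 to ⌊ n /2⌋ ] (λ k → ∑[ 2 ℕ.* k to n ] (λ m → cosSummand n m k))
        cos-swap n = ∑-triangle-swap (2 ℕ.*_) ⌊_/2⌋ 0 n (cosSummand n)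
          (λ _ → z≤n) ℕₚ.⌊n/2⌋-mono half<⇒<double (cosSummand-high n)

        sin-formula : ∀ {s} n →
          s ≡ differenceCoefficient (real lam) (real (ι ½) K.* (K.- i)) (real x K.* real μ)
                ((i K.* real y) K.* real μ) ((K.- (i K.* real y)) K.* real μ) n →
          s K.≈ real (∑[ 1 to n ] λ m → ∑[ 0 to ⌊ m ∸ 1 /2⌋ ] (sinSummand n m))
        sin-formula n s≡ = K.trans
          (K.reflexive (≡.trans s≡ (≡.sym (differenceCoefficient-unfold _ _ _ _ _ n)))) (K.trans
          (product-coefficient (degenerateSin y) (sinCoefficient y) (factorial*degenerateSin y) n)
          (real.⟦⟧-cong (trans
            (∑-cong (suc n) {g = row} λ m _ → distribute n m ⌊ m ∸ 1 /2⌋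
              (λ k → lam ^ (m ∸ 2 ℕ.* k ∸ 1)) ((- 1#) ^_) (λ k → y ^ (2 ℕ.* k ℕ.+ 1))
              (λ k → φ (S¹ m (2 ℕ.* k ℕ.+ 1))))
            -- The convolution begins at m = 0 and the asserted sum at m = 1. The row m = 0 contains
            -- only Stirling numbers `S¹ 0 l` with l > 0 and is dropped; for n = 0 nothing is left.
            (∑-drop 1 (suc n) {row} row-0))))
          where
          row : ℕ → Carrier
          row m = ∑[ 0 to ⌊ m ∸ 1 /2⌋ ] (sinSummand n m)
          row-0 : ∀ m → m ℕ.< 1 → row m ≈ 0#
          row-0 zero    _ = ∑-zero 1 {sinSummand n 0} λ k _ →
            sinSummand-high n 0 k (ℕₚ.m≤n+m 1 (2 ℕ.* k))
          row-0 (suc m) (s≤s ())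

        sin-swap : ∀ n →
          ∑[ 1 to n ] (λ m → ∑[ 0 to ⌊ m ∸ 1 /2⌋ ] (sinSummand n m)) ≈
          ∑[ 0 to ⌊ n ∸ 1 /2⌋ ] (λ k → ∑[ 2 ℕ.* k ℕ.+ 1 to n ] (λ m → sinSummand n m k))
        sin-swap n = ∑-triangle-swap (λ k → 2 ℕ.* k ℕ.+ 1) (λ m → ⌊ m ∸ 1 /2⌋) 1 n (sinSummand n)
          (λ k → ℕₚ.m≤n+m 1 (2 ℕ.* k)) (λ i≤j → ℕₚ.⌊n/2⌋-mono (ℕₚ.∸-monoˡ-≤ 1 i≤j))
          half<⇒<double+1 (sinSummand-high n)

-- The formulas over the real and complex numbers

private
  open RealNumbers using (ℝ-commutativeRing; fromℚ-isRingHomomorphism)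
  module Complex = Complexification ℝ-commutativeRing
  open DegenerateTrigonometry ℝ-commutativeRing Complex.commutativeRing
    fromℚ-isRingHomomorphism Complex.real-isRingHomomorphism Complex.conj-isRingHomomorphism
    Complex.conj-real Complex.i Complex.conj-i Complex.i*i
  open TrigonometricCoefficients ℂ-rawRing (λ q → fromℝ (fromℚ q))

theorem2p2 : (lam : ℝ) (lam#0 : lam #0) (x y : ℝ) →
    let open R in
    ((n : ℕ) →
    (cosPoly lam lam#0 n x y C.≈ fromℝ
    (∑[ 0 to n ] λ m → ∑[ 0 to ⌊ m /2⌋ ] λ k →
    fromℕ (n C m) * lam ^ (m ∸ 2 ℕ.* k) * (- 1#) ^ k * y ^ (2 ℕ.* k)
    * fromℤ (S¹ m (2 ℕ.* k)) * fallingFactorial lam x (n ∸ m)))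
    ×
    ((∑[ 0 to n ] λ m → ∑[ 0 to ⌊ m /2⌋ ] λ k →
    fromℕ (n C m) * lam ^ (m ∸ 2 ℕ.* k) * (- 1#) ^ k * y ^ (2 ℕ.* k)
    * fromℤ (S¹ m (2 ℕ.* k)) * fallingFactorial lam x (n ∸ m))
    ≈
    (∑[ 0 to ⌊ n /2⌋ ] λ k → ∑[ 2 ℕ.* k to n ] λ m →
    fromℕ (n C m) * lam ^ (m ∸ 2 ℕ.* k) * (- 1#) ^ k * y ^ (2 ℕ.* k)
    * fromℤ (S¹ m (2 ℕ.* k)) * fallingFactorial lam x (n ∸ m))))
    ×
    ((n : ℕ) → 1 ℕ.≤ n →
    (sinPoly lam lam#0 n x y C.≈ fromℝ
    (∑[ 1 to n ] λ m → ∑[ 0 to ⌊ m ∸ 1 /2⌋ ] λ k →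
    fromℕ (n C m) * lam ^ (m ∸ 2 ℕ.* k ∸ 1) * (- 1#) ^ k * y ^ (2 ℕ.* k ℕ.+ 1)
    * fromℤ (S¹ m (2 ℕ.* k ℕ.+ 1)) * fallingFactorial lam x (n ∸ m)))
    ×
    ((∑[ 1 to n ] λ m → ∑[ 0 to ⌊ m ∸ 1 /2⌋ ] λ k →
    fromℕ (n C m) * lam ^ (m ∸ 2 ℕ.* k ∸ 1) * (- 1#) ^ k * y ^ (2 ℕ.* k ℕ.+ 1)
    * fromℤ (S¹ m (2 ℕ.* k ℕ.+ 1)) * fallingFactorial lam x (n ∸ m))
    ≈
    (∑[ 0 to ⌊ n ∸ 1 /2⌋ ] λ k → ∑[ 2 ℕ.* k ℕ.+ 1 to n ] λ m →
    fromℕ (n C m) * lam ^ (m ∸ 2 ℕ.* k ∸ 1) * (- 1#) ^ k * y ^ (2 ℕ.* k ℕ.+ 1)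
    * fromℤ (S¹ m (2 ℕ.* k ℕ.+ 1)) * fallingFactorial lam x (n ∸ m))))
    ×
    (sinPoly lam lam#0 0 x y C.≈ C.0#)
theorem2p2 lam lam#0 x y =
    (λ n → cos-expansion (cosPoly lam lam#0 n x y) n (cosPoly≡ n)
         , cos-swap lam (inv lam lam#0) (inv-inverse lam lam#0) x y n)
  , (λ n _ → sin-expansion (sinPoly lam lam#0 n x y) n (sinPoly≡ n)
           , sin-swap lam (inv lam lam#0) (inv-inverse lam lam#0) x y n)
  , sin-expansion-0 (sinPoly lam lam#0 0 x y) (sinPoly≡ 0)
  where
  open R

  cosPoly≡ : ∀ n → cosPoly lam lam#0 n x y ≡
    sumCoefficient (fromℝ lam) ½ᶜ (fromℝ x C.* fromℝ (inv lam lam#0))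
      ((𝕚 C.* fromℝ y) C.* fromℝ (inv lam lam#0))
      ((C.- (𝕚 C.* fromℝ y)) C.* fromℝ (inv lam lam#0)) n
  cosPoly≡ = sumCoefficient-unfold (fromℝ lam) ½ᶜ (fromℝ x C.* fromℝ (inv lam lam#0))
      ((𝕚 C.* fromℝ y) C.* fromℝ (inv lam lam#0))
      ((C.- (𝕚 C.* fromℝ y)) C.* fromℝ (inv lam lam#0))

  sinPoly≡ : ∀ n → sinPoly lam lam#0 n x y ≡
    differenceCoefficient (fromℝ lam) 1/2𝕚 (fromℝ x C.* fromℝ (inv lam lam#0))
      ((𝕚 C.* fromℝ y) C.* fromℝ (inv lam lam#0))
      ((C.- (𝕚 C.* fromℝ y)) C.* fromℝ (inv lam lam#0)) n
  sinPoly≡ = differenceCoefficient-unfold (fromℝ lam) 1/2𝕚 (fromℝ x C.* fromℝ (inv lam lam#0))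
      ((𝕚 C.* fromℝ y) C.* fromℝ (inv lam lam#0))
      ((C.- (𝕚 C.* fromℝ y)) C.* fromℝ (inv lam lam#0))

  -- Stated for a variable s, so that the comparison with the summands of the
  -- generic formula does not unfold cosPoly and sinPoly.
  cos-expansion : ∀ s n → s ≡
    sumCoefficient (fromℝ lam) ½ᶜ (fromℝ x C.* fromℝ (inv lam lam#0))
      ((𝕚 C.* fromℝ y) C.* fromℝ (inv lam lam#0))
      ((C.- (𝕚 C.* fromℝ y)) C.* fromℝ (inv lam lam#0)) n →
    s C.≈ fromℝ (∑[ 0 to n ] λ m → ∑[ 0 to ⌊ m /2⌋ ] λ k →
      fromℕ (n C m) * lam ^ (m ∸ 2 ℕ.* k) * (- 1#) ^ k * y ^ (2 ℕ.* k)
      * fromℤ (S¹ m (2 ℕ.* k)) * fallingFactorial lam x (n ∸ m))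
  cos-expansion s n = cos-formula lam (inv lam lam#0) (inv-inverse lam lam#0) x y {s} n

  sin-expansion : ∀ s n → s ≡
    differenceCoefficient (fromℝ lam) 1/2𝕚 (fromℝ x C.* fromℝ (inv lam lam#0))
      ((𝕚 C.* fromℝ y) C.* fromℝ (inv lam lam#0))
      ((C.- (𝕚 C.* fromℝ y)) C.* fromℝ (inv lam lam#0)) n →
    s C.≈ fromℝ (∑[ 1 to n ] λ m → ∑[ 0 to ⌊ m ∸ 1 /2⌋ ] λ k →
      fromℕ (n C m) * lam ^ (m ∸ 2 ℕ.* k ∸ 1) * (- 1#) ^ k * y ^ (2 ℕ.* k ℕ.+ 1)
      * fromℤ (S¹ m (2 ℕ.* k ℕ.+ 1)) * fallingFactorial lam x (n ∸ m))
  sin-expansion s n = sin-formula lam (inv lam lam#0) (inv-inverse lam lam#0) x y {s} n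

  -- At n = 0 the outer sum from 1 to 0 is empty, so the general sine formula has the value zero.
  sin-expansion-0 : ∀ s → s ≡
    differenceCoefficient (fromℝ lam) 1/2𝕚 (fromℝ x C.* fromℝ (inv lam lam#0))
      ((𝕚 C.* fromℝ y) C.* fromℝ (inv lam lam#0))
      ((C.- (𝕚 C.* fromℝ y)) C.* fromℝ (inv lam lam#0)) 0 →
    s C.≈ C.0#
  sin-expansion-0 s = sin-formula lam (inv lam lam#0) (inv-inverse lam lam#0) x y {s} 0
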